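{- Let $G$ be a connected graph with $n\geq 2$ vertices and $m$ edges, and let $k\geq 0$ be an integer. Then $$R^*(S^k(G))=8^kR^*(G)+\frac{8^k-2^k}{3}\,m(2m-2n+1).$$
   Context: All graphs are finite, simple and connected. For a connected graph $H$, the resistance distance $\Omega_{ij}$ between vertices $i,j$ is the effective resistance between $i$ and $j$ in the electrical network obtained from $H$ by replacing each edge with a unit resistor. $d_i$ denotes the degree of vertex $i$ in $H$. The multiplicative degree-Kirchhoff index is $R^*(H)=\sum_{\{i,j\}\subseteq V(H)} d_id_j\Omega_{ij}$, summed over unordered pairs of distinct vertices. The subdivision $S(H)$ is obtained from $H$ by replacing every edge with a path of length two. The iterated subdivisions are $S^0(G)=G$ and $S^k(G)=S(S^{k-1}(G))$ for $k\geq 1$. -}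

module Defs where

open import Data.Nat as ℕ using (ℕ; zero; suc; _^_; _∸_; _<_)
open import Data.Integer using (+_)
open import Data.Fin using (Fin; toℕ; _↑ˡ_; _↑ʳ_) renaming (_≟_ to _≟ᶠ_)
open import Data.Vec using (Vec; []; _∷_; lookup; _++_; foldr)
open import Data.List using (List; allFin)
import Data.List as L
open import Data.Product using (_×_; _,_; Σ; ∃; proj₁; proj₂)
open import Data.Empty using (⊥)
open import Relation.Nullary using (¬_; yes; no)
open import Relation.Nullary.Decidable using (⌊_⌋)
open import Relation.Binary.PropositionalEquality using (_≡_; _≢_)
open import Data.Rational using (ℚ; 0ℚ; 1ℚ; _+_; _*_; _-_; _/_)

record Graph : Set where
  constructor mkGraph
  field
    nV    : ℕ
    nE    : ℕ
    edges : Vec (Fin nV × Fin nV) nE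
open Graph public

endpoints : (G : Graph) → Fin (nE G) → Fin (nV G) × Fin (nV G)
endpoints G t = lookup (edges G) t

Simple : Graph → Set
Simple G =
  (∀ t → proj₁ (endpoints G t) ≢ proj₂ (endpoints G t)) ×
  (∀ s t → s ≢ t →
     ¬ ((proj₁ (endpoints G s) ≡ proj₁ (endpoints G t) × proj₂ (endpoints G s) ≡ proj₂ (endpoints G t))
        Data.Sum.⊎ (proj₁ (endpoints G s) ≡ proj₂ (endpoints G t) × proj₂ (endpoints G s) ≡ proj₁ (endpoints G t))))
  where import Data.Sum

Adj : (G : Graph) → Fin (nV G) → Fin (nV G) → Set
Adj G i j = Σ (Fin (nE G)) λ t →
  (proj₁ (endpoints G t) ≡ i × proj₂ (endpoints G t) ≡ j) Data.Sum.⊎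
  (proj₁ (endpoints G t) ≡ j × proj₂ (endpoints G t) ≡ i)
  where import Data.Sum

data Reach (G : Graph) : Fin (nV G) → Fin (nV G) → Set where
  here : ∀ {i} → Reach G i i
  step : ∀ {i j k} → Adj G i j → Reach G j k → Reach G i k

Connected : Graph → Set
Connected G = ∀ i j → Reach G i j

-- subdivision: new vertex n + t in the middle of edge t = {u,v};
-- the edges of S(G) are {u, n+t} and {v, n+t}.
subdivEdges : ∀ {n m} → Vec (Fin n × Fin n) m → (Fin m → Fin (n ℕ.+ m)) →
              Vec (Fin (n ℕ.+ m) × Fin (n ℕ.+ m)) (m ℕ.+ m)
subdivEdges {n} {m} es mid = half proj₁ ++ half proj₂
  where
    half : (Fin n × Fin n → Fin n) → Vec (Fin (n ℕ.+ m) × Fin (n ℕ.+ m)) m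
    half f = Data.Vec.tabulate λ t → f (lookup es t) ↑ˡ m , mid t
      where import Data.Vec

S : Graph → Graph
S (mkGraph n m es) = mkGraph (n ℕ.+ m) (m ℕ.+ m) (subdivEdges es (n ↑ʳ_))

S^ : ℕ → Graph → Graph
S^ zero G = G
S^ (suc k) G = S (S^ k G)

sumℚ : List ℚ → ℚ
sumℚ = L.foldr _+_ 0ℚ

ℕtoℚ : ℕ → ℚ
ℕtoℚ x = (+ x) / 1

[_≟_] : ∀ {n} → Fin n → Fin n → ℚ
[ i ≟ j ] with i ≟ᶠ j
... | yes _ = 1ℚ
... | no  _ = 0ℚ

degree : (G : Graph) → Fin (nV G) → ℚ
degree G i = sumℚ (L.map (λ t → [ proj₁ (endpoints G t) ≟ i ] + [ proj₂ (endpoints G t) ≟ i ]) (allFin (nE G)))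

-- net current flowing out of vertex i when the vertices carry potentials x,
-- each edge being a unit resistor (Ohm's law: current u→v equals x u - x v).
outflow : (G : Graph) → (Fin (nV G) → ℚ) → Fin (nV G) → ℚ
outflow G x i = sumℚ (L.map f (allFin (nE G)))
  where
    f : Fin (nE G) → ℚ
    f t = let u = proj₁ (endpoints G t); v = proj₂ (endpoints G t) in
          [ u ≟ i ] * (x u - x v) + [ v ≟ i ] * (x v - x u)

-- ω is the effective resistance between a and b: there is a potential x such that
-- a unit current enters at a and leaves at b (Kirchhoff's current law at every vertex),
-- and ω is the resulting potential difference x a - x b.
IsResistance : (G : Graph) → Fin (nV G) → Fin (nV G) → ℚ → Set
IsResistance G a b ω = Σ (Fin (nV G) → ℚ) λ x →
  (∀ i → outflow G x i ≡ [ i ≟ a ] - [ i ≟ b ]) × (ω ≡ x a - x b)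

-- sum over unordered pairs {i,j}, i ≠ j (i.e. ordered pairs with i < j)
sumPairs : (n : ℕ) → (Fin n → Fin n → ℚ) → ℚ
sumPairs n f = sumℚ (L.map (λ i → sumℚ (L.map (λ j → g i j) (allFin n))) (allFin n))
  where
    g : Fin n → Fin n → ℚ
    g i j with toℕ i ℕ.<? toℕ j
    ... | yes _ = f i j
    ... | no  _ = 0ℚ

IsRStar : Graph → ℚ → Set
IsRStar G r = Σ (Fin (nV G) → Fin (nV G) → ℚ) λ Ω →
  (∀ i j → IsResistance G i j (Ω i j)) ×
  (r ≡ sumPairs (nV G) (λ i j → degree G i * degree G j * Ω i j))

-- Let H be connected with n vertices and m edges, and let g be its Green function normalised
-- against the degree measure: g c is the potential of a unit current entering at c and leaving every
-- vertex i in proportion to d_i / 2m, shifted so that ∑ᵢ dᵢ g c i = 0. Then the effective resistance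
-- is Ω a b = g a a − g a b − g b a + g b b, the normalisation kills the cross terms in R*, and
-- R*(H) = 2m · ∑_c d_c g c c.
-- In S(H) each edge becomes two unit resistors in series, and the Green function of S(H) can be
-- written down from g: twice g (plus a constant) on the original vertices, and on the midpoint of an
-- edge the sum of its endpoint values plus a correction. Its trace gives
-- R*(S H) = 8 R*(H) + 2m(2m − 2n + 1); as S doubles m and preserves 2m − 2n + 1, iterating this
-- recurrence gives the closed form.
-- Green functions exist since balanced Laplace equations on a connected network can be solved by
-- eliminating one vertex at a time, and resistances are unique since harmonic functions on a
-- connected graph are constant (energy argument).

module Submission where

open import Defs
open import Data.Nat using (ℕ; _≥_; _^_; _∸_) renaming (_*_ to _*ℕ_)
open import Data.Integer using (+_)
open import Data.Product using (_×_; ∃)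
open import Function.Bundles using (_⇔_)
open import Relation.Binary.PropositionalEquality using (_≡_)
open import Data.Rational using (ℚ; _+_; _*_; _-_; _/_)

open import Algebra.Bundles using (CommutativeRing)
open import Data.Empty using (⊥-elim)
open import Data.Fin as F using (Fin; zero; suc; toℕ; _↑ˡ_; _↑ʳ_; splitAt)
import Data.Fin.Properties as FP
import Data.Integer.Solver
open import Data.List using (allFin)
import Data.List as L
import Data.List.Properties as LP
open import Data.Nat as ℕ using (zero; suc)
import Data.Nat.Properties as ℕP
import Data.Nat.Solver
open import Data.Product using (Σ; _,_; proj₁; proj₂)
open import Data.Rational as Q using (0ℚ; 1ℚ; -_; _≤_; _<_)
import Data.Rational.Properties as QP
open import Data.Rational.Solver using (module +-*-Solver)
import Data.Rational.Unnormalised as ℚᵘ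
import Data.Rational.Unnormalised.Properties as ℚᵘP
open import Data.Sum using (_⊎_; inj₁; inj₂; [_,_]′)
import Data.Vec as V
import Data.Vec.Properties as VP
open import Function using (id)
open import Function.Bundles using (mk⇔)
open import Relation.Binary using (tri<; tri≈; tri>)
open import Relation.Binary.PropositionalEquality
open import Relation.Nullary using (¬_; yes; no)

open import Algebra.Properties.Semiring.Sum (CommutativeRing.semiring QP.+-*-commutativeRing)
  using (sum; sum-syntax; sum-cong-≗; ∑-distrib-+; ∑-comm; sum-replicate-zero; *-distribˡ-sum; *-distribʳ-sum)
open +-*-Solver
module ℤS = Data.Integer.Solver.+-*-Solver
module ℕS = Data.Nat.Solver.+-*-Solver

cong₃ : ∀ {A B C D : Set} (f : A → B → C → D) {a a′ b b′ c c′} → a ≡ a′ → b ≡ b′ → c ≡ c′ → f a b c ≡ f a′ b′ c′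
cong₃ f refl refl refl = refl

two half : ℚ
two = 1ℚ + 1ℚ
half = + 1 / 2

⅓ : ℚ
⅓ = + 1 / 3

ℕtoℚ≃mkℚᵘ : ∀ a → Q.toℚᵘ (ℕtoℚ a) ℚᵘ.≃ ℚᵘ.mkℚᵘ (+ a) 0
ℕtoℚ≃mkℚᵘ a = QP.toℚᵘ-fromℚᵘ (ℚᵘ.mkℚᵘ (+ a) 0)

ℕtoℚ-suc : ∀ a → ℕtoℚ (suc a) ≡ 1ℚ + ℕtoℚ a
ℕtoℚ-suc a = QP.toℚᵘ-injective (begin-equality
    Q.toℚᵘ (ℕtoℚ (suc a))                 ≃⟨ ℕtoℚ≃mkℚᵘ (suc a) ⟩
    ℚᵘ.mkℚᵘ (+ suc a) 0                    ≃⟨ ℚᵘ.*≡* (ℤS.solve 1 (λ x → (ℤS.con (+ 1) ℤS.:+ x) ℤS.:* ℤS.con (+ 1)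
                                                     ℤS.:= (ℤS.con (+ 1) ℤS.:* ℤS.con (+ 1) ℤS.:+ x ℤS.:* ℤS.con (+ 1)) ℤS.:* ℤS.con (+ 1)) refl (+ a)) ⟩
    ℚᵘ.1ℚᵘ ℚᵘ.+ ℚᵘ.mkℚᵘ (+ a) 0            ≃⟨ ℚᵘP.+-congʳ ℚᵘ.1ℚᵘ (ℚᵘP.≃-sym (ℕtoℚ≃mkℚᵘ a)) ⟩
    Q.toℚᵘ 1ℚ ℚᵘ.+ Q.toℚᵘ (ℕtoℚ a)         ≃⟨ ℚᵘP.≃-sym (QP.toℚᵘ-homo-+ 1ℚ (ℕtoℚ a)) ⟩
    Q.toℚᵘ (1ℚ + ℕtoℚ a)                   ∎)
  where open ℚᵘP.≤-Reasoning

ℕtoℚ-homo-+ : ∀ a b → ℕtoℚ (a ℕ.+ b) ≡ ℕtoℚ a + ℕtoℚ b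
ℕtoℚ-homo-+ zero    b = sym (QP.+-identityˡ (ℕtoℚ b))
ℕtoℚ-homo-+ (suc a) b = begin
    ℕtoℚ (suc (a ℕ.+ b))           ≡⟨ ℕtoℚ-suc (a ℕ.+ b) ⟩
    1ℚ + ℕtoℚ (a ℕ.+ b)            ≡⟨ cong (_+_ 1ℚ) (ℕtoℚ-homo-+ a b) ⟩
    1ℚ + (ℕtoℚ a + ℕtoℚ b)         ≡⟨ sym (QP.+-assoc 1ℚ (ℕtoℚ a) (ℕtoℚ b)) ⟩
    (1ℚ + ℕtoℚ a) + ℕtoℚ b         ≡⟨ cong (_+ ℕtoℚ b) (sym (ℕtoℚ-suc a)) ⟩
    ℕtoℚ (suc a) + ℕtoℚ b          ∎
  where open ≡-Reasoning

ℕtoℚ-homo-* : ∀ a b → ℕtoℚ (a ℕ.* b) ≡ ℕtoℚ a * ℕtoℚ b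
ℕtoℚ-homo-* zero    b = sym (QP.*-zeroˡ (ℕtoℚ b))
ℕtoℚ-homo-* (suc a) b = begin
    ℕtoℚ (b ℕ.+ a ℕ.* b)           ≡⟨ ℕtoℚ-homo-+ b (a ℕ.* b) ⟩
    ℕtoℚ b + ℕtoℚ (a ℕ.* b)        ≡⟨ cong (_+_ (ℕtoℚ b)) (ℕtoℚ-homo-* a b) ⟩
    ℕtoℚ b + ℕtoℚ a * ℕtoℚ b       ≡⟨ solve 2 (λ x y → y :+ x :* y := (con 1ℚ :+ x) :* y) refl (ℕtoℚ a) (ℕtoℚ b) ⟩
    (1ℚ + ℕtoℚ a) * ℕtoℚ b         ≡⟨ cong (_* ℕtoℚ b) (sym (ℕtoℚ-suc a)) ⟩
    ℕtoℚ (suc a) * ℕtoℚ b          ∎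
  where open ≡-Reasoning

ℕ/≡ℕtoℚ*1/ : ∀ a d → (+ a) / suc d ≡ ℕtoℚ a * (+ 1 / suc d)
ℕ/≡ℕtoℚ*1/ a d = QP.toℚᵘ-injective (begin-equality
    Q.toℚᵘ ((+ a) / suc d)                    ≃⟨ QP.toℚᵘ-fromℚᵘ (ℚᵘ.mkℚᵘ (+ a) d) ⟩
    ℚᵘ.mkℚᵘ (+ a) d                            ≃⟨ ℚᵘ.*≡* (ℤS.solve 2 (λ x e → x ℤS.:* (ℤS.con (+ 1) ℤS.:* e) ℤS.:= (x ℤS.:* ℤS.con (+ 1)) ℤS.:* e) refl (+ a) (+ suc d)) ⟩
    ℚᵘ.mkℚᵘ (+ a) 0 ℚᵘ.* ℚᵘ.mkℚᵘ (+ 1) d       ≃⟨ ℚᵘP.*-cong (ℚᵘP.≃-sym (ℕtoℚ≃mkℚᵘ a)) (ℚᵘP.≃-sym (QP.toℚᵘ-fromℚᵘ (ℚᵘ.mkℚᵘ (+ 1) d))) ⟩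
    Q.toℚᵘ (ℕtoℚ a) ℚᵘ.* Q.toℚᵘ (+ 1 / suc d)   ≃⟨ ℚᵘP.≃-sym (QP.toℚᵘ-homo-* (ℕtoℚ a) (+ 1 / suc d)) ⟩
    Q.toℚᵘ (ℕtoℚ a * (+ 1 / suc d))            ∎)
  where open ℚᵘP.≤-Reasoning

ℕtoℚ-pos : ∀ {a} → Fin a → 0ℚ < ℕtoℚ a
ℕtoℚ-pos {suc a} _ = QP.positive⁻¹ (ℕtoℚ (suc a)) {{QP.normalize-pos (suc a) 1}}

*-nonNeg : ∀ {p q} → 0ℚ ≤ p → 0ℚ ≤ q → 0ℚ ≤ p * q
*-nonNeg {p} {q} 0≤p 0≤q = QP.nonNegative⁻¹ (p * q) {{QP.nonNeg*nonNeg⇒nonNeg p {{Q.nonNegative 0≤p}} q {{Q.nonNegative 0≤q}}}}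

*-pos : ∀ {p q} → 0ℚ < p → 0ℚ < q → 0ℚ < p * q
*-pos {p} {q} 0<p 0<q = QP.positive⁻¹ (p * q) {{QP.pos*pos⇒pos p {{Q.positive 0<p}} q {{Q.positive 0<q}}}}

square-neg : ∀ p → - p * - p ≡ p * p
square-neg = solve 1 (λ p → (:- p) :* (:- p) := p :* p) refl

square-nonNeg : ∀ p → 0ℚ ≤ p * p
square-nonNeg p with QP.≤-total 0ℚ p
... | inj₁ 0≤p = *-nonNeg 0≤p 0≤p
... | inj₂ p≤0 = subst (0ℚ ≤_) (square-neg p) (*-nonNeg (QP.neg-antimono-≤ p≤0) (QP.neg-antimono-≤ p≤0))

square≡0⇒≡0 : ∀ p → p * p ≡ 0ℚ → p ≡ 0ℚ
square≡0⇒≡0 p p²≡0 with QP.<-cmp p 0ℚ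
... | tri≈ _ p≡0 _ = p≡0
... | tri> _ _ 0<p = ⊥-elim (QP.<⇒≢ (*-pos 0<p 0<p) (sym p²≡0))
... | tri< p<0 _ _ = ⊥-elim (QP.<⇒≢ (subst (0ℚ <_) (square-neg p) (*-pos (QP.neg-antimono-< p<0) (QP.neg-antimono-< p<0))) (sym p²≡0))

x+x≡y+y⇒x≡y : ∀ {x y} → x + x ≡ y + y → x ≡ y
x+x≡y+y⇒x≡y {x} {y} x+x≡y+y = begin
    x                ≡⟨ solve 1 (λ x → x := con half :* (x :+ x)) refl x ⟩
    half * (x + x)   ≡⟨ cong (half *_) x+x≡y+y ⟩
    half * (y + y)   ≡⟨ solve 1 (λ y → con half :* (y :+ y) := y) refl y ⟩
    y                ∎
  where open ≡-Reasoning

sumℚ-allFin : ∀ n (f : Fin n → ℚ) → sumℚ (L.map f (allFin n)) ≡ ∑[ i < n ] f i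
sumℚ-allFin n f = trans (cong sumℚ (LP.map-tabulate id f)) (sumℚ-tabulate n f)
  where
  sumℚ-tabulate : ∀ n (f : Fin n → ℚ) → sumℚ (L.tabulate f) ≡ ∑[ i < n ] f i
  sumℚ-tabulate zero    f = refl
  sumℚ-tabulate (suc n) f = cong (_+_ (f zero)) (sumℚ-tabulate n (λ i → f (suc i)))

∑-neg : ∀ n (f : Fin n → ℚ) → ∑[ i < n ] (- f i) ≡ - ∑[ i < n ] f i
∑-neg zero    f = refl
∑-neg (suc n) f = trans (cong (_+_ (- f zero)) (∑-neg n (λ i → f (suc i)))) (sym (QP.neg-distrib-+ (f zero) _))

∑-distrib-- : ∀ n (f g : Fin n → ℚ) → ∑[ i < n ] (f i - g i) ≡ ∑[ i < n ] f i - ∑[ i < n ] g i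
∑-distrib-- n f g = trans (∑-distrib-+ f (λ i → - g i)) (cong (_+_ (∑[ i < n ] f i)) (∑-neg n g))

∑-distrib-−−+ : ∀ n (p q r s : Fin n → ℚ) →
  ∑[ i < n ] (p i - q i - r i + s i) ≡ ∑[ i < n ] p i - ∑[ i < n ] q i - ∑[ i < n ] r i + ∑[ i < n ] s i
∑-distrib-−−+ n p q r s = trans (∑-distrib-+ (λ i → p i - q i - r i) s)
  (cong (_+ ∑[ i < n ] s i) (trans (∑-distrib-- n (λ i → p i - q i) r) (cong (_- ∑[ i < n ] r i) (∑-distrib-- n p q))))

∑-*ˡ : ∀ n c (f : Fin n → ℚ) → ∑[ i < n ] (c * f i) ≡ c * ∑[ i < n ] f i
∑-*ˡ n c f = sym (*-distribˡ-sum c f)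

∑-*ʳ : ∀ n c (f : Fin n → ℚ) → ∑[ i < n ] (f i * c) ≡ ∑[ i < n ] f i * c
∑-*ʳ n c f = sym (*-distribʳ-sum c f)

∑-const : ∀ n c → ∑[ i < n ] c ≡ ℕtoℚ n * c
∑-const zero    c = sym (QP.*-zeroˡ c)
∑-const (suc n) c = begin
    c + ∑[ i < n ] c     ≡⟨ cong (_+_ c) (∑-const n c) ⟩
    c + ℕtoℚ n * c       ≡⟨ solve 2 (λ c x → c :+ x :* c := (con 1ℚ :+ x) :* c) refl c (ℕtoℚ n) ⟩
    (1ℚ + ℕtoℚ n) * c    ≡⟨ cong (_* c) (sym (ℕtoℚ-suc n)) ⟩
    ℕtoℚ (suc n) * c     ∎
  where open ≡-Reasoning

∑-↑ : ∀ a b (f : Fin (a ℕ.+ b) → ℚ) → ∑[ k < a ℕ.+ b ] f k ≡ ∑[ i < a ] f (i ↑ˡ b) + ∑[ j < b ] f (a ↑ʳ j)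
∑-↑ zero    b f = sym (QP.+-identityˡ _)
∑-↑ (suc a) b f = trans (cong (_+_ (f zero)) (∑-↑ a b (λ i → f (suc i)))) (sym (QP.+-assoc (f zero) _ _))

∑-nonNeg : ∀ n (f : Fin n → ℚ) → (∀ i → 0ℚ ≤ f i) → 0ℚ ≤ ∑[ i < n ] f i
∑-nonNeg zero    f 0≤f = QP.≤-refl
∑-nonNeg (suc n) f 0≤f = QP.+-mono-≤ (0≤f zero) (∑-nonNeg n _ (λ i → 0≤f (suc i)))

term≤∑ : ∀ n (f : Fin n → ℚ) → (∀ i → 0ℚ ≤ f i) → ∀ t → f t ≤ ∑[ i < n ] f i
term≤∑ (suc n) f 0≤f = bound
  where
  rest : ℚ
  rest = ∑[ i < n ] f (suc i)
  bound : ∀ t → f t ≤ f zero + rest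
  bound zero = subst (_≤ f zero + rest) (QP.+-identityʳ (f zero))
    (QP.+-monoʳ-≤ (f zero) (∑-nonNeg n _ (λ i → 0≤f (suc i))))
  bound (suc t) = QP.≤-trans (term≤∑ n _ (λ i → 0≤f (suc i)) t)
    (subst (_≤ f zero + rest) (QP.+-identityˡ rest) (QP.+-monoˡ-≤ rest (0≤f zero)))

∑≡0⇒term≡0 : ∀ n (f : Fin n → ℚ) → (∀ i → 0ℚ ≤ f i) → ∑[ i < n ] f i ≡ 0ℚ → ∀ t → f t ≡ 0ℚ
∑≡0⇒term≡0 n f 0≤f ∑≡0 t = QP.≤-antisym (subst (f t ≤_) ∑≡0 (term≤∑ n f 0≤f t)) (0≤f t)

δ-refl : ∀ {n} (i : Fin n) → [ i ≟ i ] ≡ 1ℚ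
δ-refl i with i F.≟ i
... | yes _   = refl
... | no i≢i = ⊥-elim (i≢i refl)

δ-≢ : ∀ {n} {i j : Fin n} → i ≢ j → [ i ≟ j ] ≡ 0ℚ
δ-≢ {i = i} {j} i≢j with i F.≟ j
... | yes i≡j = ⊥-elim (i≢j i≡j)
... | no _    = refl

δ-sym : ∀ {n} (i j : Fin n) → [ i ≟ j ] ≡ [ j ≟ i ]
δ-sym i j with i F.≟ j
... | yes refl = sym (δ-refl i)
... | no i≢j   = sym (δ-≢ (λ j≡i → i≢j (sym j≡i)))

δ-injective : ∀ {n m} (g : Fin n → Fin m) → (∀ {a b} → g a ≡ g b → a ≡ b) →
              ∀ a b → [ g a ≟ g b ] ≡ [ a ≟ b ]
δ-injective g g-inj a b with a F.≟ b
... | yes refl = δ-refl (g a)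
... | no a≢b   = δ-≢ (λ ga≡gb → a≢b (g-inj ga≡gb))

δ-nonNeg : ∀ {n} (i j : Fin n) → 0ℚ ≤ [ i ≟ j ]
δ-nonNeg i j with i F.≟ j
... | yes _ = QP.nonNegative⁻¹ 1ℚ
... | no _  = QP.≤-refl

δ-*-transport : ∀ {n} (f : Fin n → ℚ) (i j : Fin n) → [ i ≟ j ] * f i ≡ [ i ≟ j ] * f j
δ-*-transport f i j with i F.≟ j
... | yes refl = refl
... | no _     = trans (QP.*-zeroˡ (f i)) (sym (QP.*-zeroˡ (f j)))

∑-δˡ : ∀ n (a : Fin n) (f : Fin n → ℚ) → ∑[ i < n ] ([ a ≟ i ] * f i) ≡ f a
∑-δˡ (suc n) zero f = begin
    [ zero ≟ zero {n} ] * f zero + ∑[ i < n ] ([ zero ≟ suc i ] * f (suc i))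
  ≡⟨ cong₂ _+_ (cong (_* f zero) (δ-refl {suc n} zero)) (sum-cong-≗ (λ i → trans (cong (_* f (suc i)) (δ-≢ {i = zero} {suc i} λ ())) (QP.*-zeroˡ (f (suc i))))) ⟩
    1ℚ * f zero + ∑[ i < n ] 0ℚ
  ≡⟨ cong (_+_ (1ℚ * f zero)) (sum-replicate-zero n) ⟩
    1ℚ * f zero + 0ℚ
  ≡⟨ solve 1 (λ x → con 1ℚ :* x :+ con 0ℚ := x) refl (f zero) ⟩
    f zero ∎
  where open ≡-Reasoning
∑-δˡ (suc n) (suc a) f = begin
    [ suc a ≟ zero ] * f zero + ∑[ i < n ] ([ suc a ≟ suc i ] * f (suc i))
  ≡⟨ cong₂ _+_ (trans (cong (_* f zero) (δ-≢ {i = suc a} {zero} λ ())) (QP.*-zeroˡ (f zero)))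
               (sum-cong-≗ (λ i → cong (_* f (suc i)) (δ-injective suc FP.suc-injective a i))) ⟩
    0ℚ + ∑[ i < n ] ([ a ≟ i ] * f (suc i))
  ≡⟨ trans (QP.+-identityˡ _) (∑-δˡ n a (λ i → f (suc i))) ⟩
    f (suc a) ∎
  where open ≡-Reasoning

∑-δʳ : ∀ n (a : Fin n) (f : Fin n → ℚ) → ∑[ i < n ] ([ i ≟ a ] * f i) ≡ f a
∑-δʳ n a f = trans (sum-cong-≗ (λ i → cong (_* f i) (δ-sym i a))) (∑-δˡ n a f)

∑-δ : ∀ n (a : Fin n) → ∑[ i < n ] [ i ≟ a ] ≡ 1ℚ
∑-δ n a = trans (sum-cong-≗ (λ i → sym (QP.*-identityʳ [ i ≟ a ]))) (∑-δʳ n a (λ _ → 1ℚ))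

aboveDiagonal : ∀ n → (Fin n → Fin n → ℚ) → Fin n → Fin n → ℚ
aboveDiagonal n f i j with toℕ i ℕ.<? toℕ j
... | yes _ = f i j
... | no _  = 0ℚ

aboveDiagonal-< : ∀ n f {i j : Fin n} → toℕ i ℕ.< toℕ j → aboveDiagonal n f i j ≡ f i j
aboveDiagonal-< n f {i} {j} i<j with toℕ i ℕ.<? toℕ j
... | yes _   = refl
... | no i≮j = ⊥-elim (i≮j i<j)

aboveDiagonal-≮ : ∀ n f {i j : Fin n} → ¬ toℕ i ℕ.< toℕ j → aboveDiagonal n f i j ≡ 0ℚ
aboveDiagonal-≮ n f {i} {j} i≮j with toℕ i ℕ.<? toℕ j
... | yes i<j = ⊥-elim (i≮j i<j)
... | no _    = refl

-- The summand of sumPairs is local to its definition; this names it, so that `with` can inspect it.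
private
  sumPairs-summand : ∀ n f → Σ (Fin n → Fin n → ℚ) λ h →
    sumPairs n f ≡ sumℚ (L.map (λ i → sumℚ (L.map (h i) (allFin n))) (allFin n))
  sumPairs-summand n f = _ , refl

  sumPairs-summand≡aboveDiagonal : ∀ n f i j → proj₁ (sumPairs-summand n f) i j ≡ aboveDiagonal n f i j
  sumPairs-summand≡aboveDiagonal n f i j with toℕ i ℕ.<? toℕ j
  ... | yes _ = refl
  ... | no _  = refl

sumPairs≡∑∑ : ∀ n f → sumPairs n f ≡ ∑[ i < n ] ∑[ j < n ] aboveDiagonal n f i j
sumPairs≡∑∑ n f = trans (sumℚ-allFin n _) (sum-cong-≗ λ i → trans (sumℚ-allFin n _)
  (sum-cong-≗ (sumPairs-summand≡aboveDiagonal n f i)))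

sumPairs-cong : ∀ n {f f′ : Fin n → Fin n → ℚ} → (∀ i j → f i j ≡ f′ i j) → sumPairs n f ≡ sumPairs n f′
sumPairs-cong n {f} {f′} f≗f′ = begin
    sumPairs n f                                    ≡⟨ sumPairs≡∑∑ n f ⟩
    ∑[ i < n ] ∑[ j < n ] aboveDiagonal n f i j    ≡⟨ sum-cong-≗ (λ i → sum-cong-≗ (above i)) ⟩
    ∑[ i < n ] ∑[ j < n ] aboveDiagonal n f′ i j   ≡⟨ sym (sumPairs≡∑∑ n f′) ⟩
    sumPairs n f′                                   ∎
  where
  open ≡-Reasoning
  above : ∀ i j → aboveDiagonal n f i j ≡ aboveDiagonal n f′ i j
  above i j with toℕ i ℕ.<? toℕ j
  ... | yes _ = f≗f′ i j
  ... | no _  = refl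

∑∑≡sumPairs+sumPairs : ∀ n (f : Fin n → Fin n → ℚ) → (∀ i j → f i j ≡ f j i) → (∀ i → f i i ≡ 0ℚ) →
  ∑[ i < n ] ∑[ j < n ] f i j ≡ sumPairs n f + sumPairs n f
∑∑≡sumPairs+sumPairs n f f-sym f-diag = begin
    ∑[ i < n ] ∑[ j < n ] f i j
  ≡⟨ sum-cong-≗ (λ i → sum-cong-≗ (split i)) ⟩
    ∑[ i < n ] ∑[ j < n ] (above i j + above j i)
  ≡⟨ trans (sum-cong-≗ (λ i → ∑-distrib-+ (above i) (λ j → above j i))) (∑-distrib-+ (λ i → ∑[ j < n ] above i j) (λ i → ∑[ j < n ] above j i)) ⟩
    ∑[ i < n ] ∑[ j < n ] above i j + ∑[ i < n ] ∑[ j < n ] above j i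
  ≡⟨ cong (_+_ (∑[ i < n ] ∑[ j < n ] above i j)) (∑-comm (λ i j → above j i)) ⟩
    ∑[ i < n ] ∑[ j < n ] above i j + ∑[ j < n ] ∑[ i < n ] above j i
  ≡⟨ sym (cong₂ _+_ (sumPairs≡∑∑ n f) (sumPairs≡∑∑ n f)) ⟩
    sumPairs n f + sumPairs n f ∎
  where
  open ≡-Reasoning
  above : Fin n → Fin n → ℚ
  above = aboveDiagonal n f
  split : ∀ i j → f i j ≡ above i j + above j i
  split i j with ℕP.<-cmp (toℕ i) (toℕ j)
  ... | tri< i<j _ j≮i = sym (trans (cong₂ _+_ (aboveDiagonal-< n f i<j) (aboveDiagonal-≮ n f j≮i)) (QP.+-identityʳ (f i j)))
  ... | tri> i≮j _ j<i = sym (trans (cong₂ _+_ (aboveDiagonal-≮ n f i≮j) (aboveDiagonal-< n f j<i))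
                                    (trans (QP.+-identityˡ (f j i)) (sym (f-sym i j))))
  ... | tri≈ i≮j i≡j _ with FP.toℕ-injective i≡j
  ...   | refl = trans (f-diag i) (sym (cong₂ _+_ (aboveDiagonal-≮ n f i≮j) (aboveDiagonal-≮ n f i≮j)))

-- Walks and sums over the edges of a graph

adj-sym : ∀ {H i j} → Adj H i j → Adj H j i
adj-sym (t , inj₁ ends) = t , inj₂ ends
adj-sym (t , inj₂ ends) = t , inj₁ ends

reach-++ : ∀ {H i j k} → Reach H i j → Reach H j k → Reach H i k
reach-++ here       r′ = r′
reach-++ (step a r) r′ = step a (reach-++ r r′)

module EdgeSums (H : Graph) where
  n m : ℕ
  n = nV H
  m = nE H

  u v : Fin m → Fin n
  u t = proj₁ (endpoints H t)
  v t = proj₂ (endpoints H t)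

  degree≡∑ : ∀ i → degree H i ≡ ∑[ t < m ] ([ u t ≟ i ] + [ v t ≟ i ])
  degree≡∑ i = sumℚ-allFin m _

  edgeOutflow : (Fin n → ℚ) → Fin n → Fin m → ℚ
  edgeOutflow x i t = [ u t ≟ i ] * (x (u t) - x (v t)) + [ v t ≟ i ] * (x (v t) - x (u t))

  outflow≡∑ : ∀ x i → outflow H x i ≡ ∑[ t < m ] edgeOutflow x i t
  outflow≡∑ x i = sumℚ-allFin m _

  outflow-cong : ∀ {x y} → (∀ j → x j ≡ y j) → ∀ i → outflow H x i ≡ outflow H y i
  outflow-cong {x} {y} x≗y i = begin
      outflow H x i
    ≡⟨ outflow≡∑ x i ⟩
      ∑[ t < m ] edgeOutflow x i t
    ≡⟨ sum-cong-≗ (λ t → cong₂ (λ p q → [ u t ≟ i ] * (p - q) + [ v t ≟ i ] * (q - p)) (x≗y (u t)) (x≗y (v t))) ⟩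
      ∑[ t < m ] edgeOutflow y i t
    ≡⟨ sym (outflow≡∑ y i) ⟩
      outflow H y i ∎
    where open ≡-Reasoning

  ∑-δ₂ : ∀ (a b : Fin n) (F G : Fin n → ℚ) → ∑[ i < n ] ([ a ≟ i ] * F i + [ b ≟ i ] * G i) ≡ F a + G b
  ∑-δ₂ a b F G = trans (∑-distrib-+ (λ i → [ a ≟ i ] * F i) (λ i → [ b ≟ i ] * G i)) (cong₂ _+_ (∑-δˡ n a F) (∑-δˡ n b G))

  handshake : ∀ (F : Fin n → ℚ) → ∑[ i < n ] (degree H i * F i) ≡ ∑[ t < m ] (F (u t) + F (v t))
  handshake F = begin
      ∑[ i < n ] (degree H i * F i)
    ≡⟨ sum-cong-≗ (λ i → trans (cong (_* F i) (degree≡∑ i)) (sym (∑-*ʳ m (F i) (λ t → [ u t ≟ i ] + [ v t ≟ i ])))) ⟩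
      ∑[ i < n ] ∑[ t < m ] (([ u t ≟ i ] + [ v t ≟ i ]) * F i)
    ≡⟨ ∑-comm (λ i t → ([ u t ≟ i ] + [ v t ≟ i ]) * F i) ⟩
      ∑[ t < m ] ∑[ i < n ] (([ u t ≟ i ] + [ v t ≟ i ]) * F i)
    ≡⟨ sum-cong-≗ (λ t → trans (sum-cong-≗ (λ i → QP.*-distribʳ-+ (F i) [ u t ≟ i ] [ v t ≟ i ])) (∑-δ₂ (u t) (v t) F F)) ⟩
      ∑[ t < m ] (F (u t) + F (v t)) ∎
    where open ≡-Reasoning

  ∑-degree : ∑[ i < n ] degree H i ≡ ℕtoℚ m * two
  ∑-degree = begin
      ∑[ i < n ] degree H i            ≡⟨ sum-cong-≗ (λ i → sym (QP.*-identityʳ (degree H i))) ⟩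
      ∑[ i < n ] (degree H i * 1ℚ)     ≡⟨ handshake (λ _ → 1ℚ) ⟩
      ∑[ t < m ] two                   ≡⟨ ∑-const m two ⟩
      ℕtoℚ m * two                     ∎
    where open ≡-Reasoning

  outflow-affine : ∀ a b c (x y : Fin n → ℚ) i →
    outflow H (λ j → a * x j + b * y j + c) i ≡ a * outflow H x i + b * outflow H y i
  outflow-affine a b c x y i = begin
      outflow H (λ j → a * x j + b * y j + c) i
    ≡⟨ outflow≡∑ (λ j → a * x j + b * y j + c) i ⟩
      ∑[ t < m ] edgeOutflow (λ j → a * x j + b * y j + c) i t
    ≡⟨ sum-cong-≗ (λ t → solve 9 (λ a b c p q xu xv yu yv →
           p :* ((a :* xu :+ b :* yu :+ c) :- (a :* xv :+ b :* yv :+ c)) :+ q :* ((a :* xv :+ b :* yv :+ c) :- (a :* xu :+ b :* yu :+ c))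
           := a :* (p :* (xu :- xv) :+ q :* (xv :- xu)) :+ b :* (p :* (yu :- yv) :+ q :* (yv :- yu))) refl
           a b c [ u t ≟ i ] [ v t ≟ i ] (x (u t)) (x (v t)) (y (u t)) (y (v t))) ⟩
      ∑[ t < m ] (a * edgeOutflow x i t + b * edgeOutflow y i t)
    ≡⟨ trans (∑-distrib-+ (λ t → a * edgeOutflow x i t) (λ t → b * edgeOutflow y i t))
             (cong₂ _+_ (∑-*ˡ m a (edgeOutflow x i)) (∑-*ˡ m b (edgeOutflow y i))) ⟩
      a * ∑[ t < m ] edgeOutflow x i t + b * ∑[ t < m ] edgeOutflow y i t
    ≡⟨ sym (cong₂ _+_ (cong (a *_) (outflow≡∑ x i)) (cong (b *_) (outflow≡∑ y i))) ⟩
      a * outflow H x i + b * outflow H y i ∎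
    where open ≡-Reasoning

  ∑-outflow-diagonal : ∀ (g : Fin n → Fin n → ℚ) → ∑[ i < n ] outflow H (g i) i
          ≡ ∑[ t < m ] ((g (u t) (u t) - g (u t) (v t)) + (g (v t) (v t) - g (v t) (u t)))
  ∑-outflow-diagonal g = begin
      ∑[ i < n ] outflow H (g i) i
    ≡⟨ sum-cong-≗ (λ i → outflow≡∑ (g i) i) ⟩
      ∑[ i < n ] ∑[ t < m ] edgeOutflow (g i) i t
    ≡⟨ ∑-comm (λ i t → edgeOutflow (g i) i t) ⟩
      ∑[ t < m ] ∑[ i < n ] ([ u t ≟ i ] * (g i (u t) - g i (v t)) + [ v t ≟ i ] * (g i (v t) - g i (u t)))
    ≡⟨ sum-cong-≗ (λ t → ∑-δ₂ (u t) (v t) (λ i → g i (u t) - g i (v t)) (λ i → g i (v t) - g i (u t))) ⟩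
      ∑[ t < m ] ((g (u t) (u t) - g (u t) (v t)) + (g (v t) (v t) - g (v t) (u t))) ∎
    where open ≡-Reasoning

  energy : ∀ (z : Fin n → ℚ) → ∑[ i < n ] (z i * outflow H z i) ≡ ∑[ t < m ] ((z (u t) - z (v t)) * (z (u t) - z (v t)))
  energy z = begin
      ∑[ i < n ] (z i * outflow H z i)
    ≡⟨ sum-cong-≗ (λ i → trans (cong (z i *_) (outflow≡∑ z i)) (sym (∑-*ˡ m (z i) (edgeOutflow z i)))) ⟩
      ∑[ i < n ] ∑[ t < m ] (z i * edgeOutflow z i t)
    ≡⟨ ∑-comm (λ i t → z i * edgeOutflow z i t) ⟩
      ∑[ t < m ] ∑[ i < n ] (z i * edgeOutflow z i t)
    ≡⟨ sum-cong-≗ (λ t → trans (sum-cong-≗ (λ i → solve 5 (λ zi p q a b → zi :* (p :* a :+ q :* b) := p :* (zi :* a) :+ q :* (zi :* b)) refl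
            (z i) [ u t ≟ i ] [ v t ≟ i ] (z (u t) - z (v t)) (z (v t) - z (u t))))
            (trans (∑-δ₂ (u t) (v t) (λ i → z i * (z (u t) - z (v t))) (λ i → z i * (z (v t) - z (u t))))
              (solve 2 (λ a b → a :* (a :- b) :+ b :* (b :- a) := (a :- b) :* (a :- b)) refl (z (u t)) (z (v t))))) ⟩
      ∑[ t < m ] ((z (u t) - z (v t)) * (z (u t) - z (v t))) ∎
    where open ≡-Reasoning

harmonic-constant : ∀ H → Connected H → ∀ z → (∀ i → outflow H z i ≡ 0ℚ) → ∀ i j → z i ≡ z j
harmonic-constant H connected z harmonic i j = along (connected i j)
  where
  open EdgeSums H
  Δ : Fin m → ℚ
  Δ t = z (u t) - z (v t)
  ∑Δ²≡0 : ∑[ t < m ] (Δ t * Δ t) ≡ 0ℚ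
  ∑Δ²≡0 = begin
      ∑[ t < m ] (Δ t * Δ t)            ≡⟨ sym (energy z) ⟩
      ∑[ i < n ] (z i * outflow H z i)  ≡⟨ sum-cong-≗ (λ i → trans (cong (z i *_) (harmonic i)) (QP.*-zeroʳ (z i))) ⟩
      ∑[ i < n ] 0ℚ                      ≡⟨ sum-replicate-zero n ⟩
      0ℚ                                 ∎
    where open ≡-Reasoning
  flat : ∀ t → z (u t) ≡ z (v t)
  flat t = begin
      z (u t)            ≡⟨ solve 2 (λ a b → a := (a :- b) :+ b) refl (z (u t)) (z (v t)) ⟩
      Δ t + z (v t)      ≡⟨ cong (_+ z (v t)) (square≡0⇒≡0 (Δ t) (∑≡0⇒term≡0 m (λ t → Δ t * Δ t) (λ t → square-nonNeg (Δ t)) ∑Δ²≡0 t)) ⟩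
      0ℚ + z (v t)       ≡⟨ QP.+-identityˡ (z (v t)) ⟩
      z (v t)            ∎
    where open ≡-Reasoning
  along : ∀ {i j} → Reach H i j → z i ≡ z j
  along here = refl
  along (step (t , inj₁ (refl , refl)) r) = trans (flat t) (along r)
  along (step (t , inj₂ (refl , refl)) r) = trans (sym (flat t)) (along r)

-- Laplace equations on connected networks

Weights : ℕ → Set
Weights n = Fin n → Fin n → ℚ

laplacian : ∀ {n} → Weights n → (Fin n → ℚ) → Fin n → ℚ
laplacian {n} w x i = ∑[ j < n ] (w i j * (x i - x j))

data Linked {n} (w : Weights n) : Fin n → Fin n → Set where
  here : ∀ {i} → Linked w i i
  step : ∀ {i k j} → 0ℚ < w i k → Linked w k j → Linked w i j

record ConnectedNetwork (n : ℕ) : Set where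
  field
    w        : Weights n
    w-sym    : ∀ i j → w i j ≡ w j i
    w-nonNeg : ∀ i j → 0ℚ ≤ w i j
    linked   : ∀ i j → Linked w i j

PoissonSolvable : ℕ → Set
PoissonSolvable n = (net : ConnectedNetwork n) (b : Fin n → ℚ) → ∑[ i < n ] b i ≡ 0ℚ →
  Σ (Fin n → ℚ) λ x → ∀ i → laplacian (ConnectedNetwork.w net) x i ≡ b i

-- Kron reduction: eliminating vertex 0 replaces the star at 0 by the mesh
-- w′ i j = w i j + w i 0 * w 0 j / D on the remaining vertices, D being the total conductance at 0.
-- The vertex j₀ only witnesses that there is a remaining vertex, which makes D positive.
module KronReduction {N} (net : ConnectedNetwork (suc N)) (j₀ : Fin N) where
  open ConnectedNetwork net

  D : ℚ
  D = ∑[ j < N ] w zero (suc j)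

  D-pos : 0ℚ < D
  D-pos = let (l , 0<w) = firstNeighbour (linked zero (suc j₀)) in
          QP.<-≤-trans 0<w (term≤∑ N (λ j → w zero (suc j)) (λ j → w-nonNeg zero (suc j)) l)
    where
    firstNeighbour : ∀ {j} → Linked w zero (suc j) → Σ (Fin N) λ l → 0ℚ < w zero (suc l)
    firstNeighbour (step {k = zero} _ r)  = firstNeighbour r
    firstNeighbour (step {k = suc l} 0<w _) = l , 0<w

  instance
    D≢0 : Q.NonZero D
    D≢0 = QP.pos⇒nonZero D {{Q.positive D-pos}}

  μ : ℚ
  μ = Q.1/ D

  Dμ≡1 : D * μ ≡ 1ℚ
  Dμ≡1 = QP.*-inverseʳ D

  μ-pos : 0ℚ < μ
  μ-pos = QP.positive⁻¹ μ {{QP.1/pos⇒pos D {{Q.positive D-pos}}}}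

  μ-nonNeg : 0ℚ ≤ μ
  μ-nonNeg = QP.<⇒≤ μ-pos

  w′ : Weights N
  w′ i j = w (suc i) (suc j) + w (suc i) zero * w zero (suc j) * μ

  w′-linked : ∀ i j → Linked w′ i j
  w′-linked i j = from-suc i (linked (suc i) (suc j))
    where
    via-rest : ∀ {i j} → 0ℚ < w (suc i) (suc j) → 0ℚ < w′ i j
    via-rest 0<w = QP.+-mono-<-≤ 0<w (*-nonNeg (*-nonNeg (w-nonNeg _ _) (w-nonNeg _ _)) μ-nonNeg)
    via-zero : ∀ {i j} → 0ℚ < w (suc i) zero → 0ℚ < w zero (suc j) → 0ℚ < w′ i j
    via-zero 0<wi0 0<w0j = QP.+-mono-≤-< (w-nonNeg _ _) (*-pos (*-pos 0<wi0 0<w0j) μ-pos)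
    mutual
      from-suc : ∀ i {j} → Linked w (suc i) (suc j) → Linked w′ i j
      from-suc i here                   = here
      from-suc i (step {k = zero} p r)  = through-zero i p r
      from-suc i (step {k = suc l} p r) = step (via-rest p) (from-suc l r)
      through-zero : ∀ i {j} → 0ℚ < w (suc i) zero → Linked w zero (suc j) → Linked w′ i j
      through-zero i q (step {k = zero} p r)  = through-zero i q r
      through-zero i q (step {k = suc l} p r) = step (via-zero q p) (from-suc l r)

  reduced : ConnectedNetwork N
  reduced = record
    { w        = w′
    ; w-sym    = λ i j → cong₂ (λ a b → a + b * μ) (w-sym (suc i) (suc j))
                   (trans (cong₂ _*_ (w-sym (suc i) zero) (w-sym zero (suc j))) (QP.*-comm (w zero (suc i)) (w (suc j) zero)))
    ; w-nonNeg = λ i j → QP.+-mono-≤ (w-nonNeg _ _) (*-nonNeg (*-nonNeg (w-nonNeg _ _) (w-nonNeg _ _)) μ-nonNeg)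
    ; linked   = w′-linked
    }

  module _ (b : Fin (suc N) → ℚ) where
    b′ : Fin N → ℚ
    b′ i = b (suc i) + w (suc i) zero * (b zero * μ)

    b′-balanced : ∑[ i < suc N ] b i ≡ 0ℚ → ∑[ i < N ] b′ i ≡ 0ℚ
    b′-balanced ∑b≡0 = begin
        ∑[ i < N ] b′ i
      ≡⟨ ∑-distrib-+ (λ i → b (suc i)) (λ i → w (suc i) zero * (b zero * μ)) ⟩
        ∑[ i < N ] b (suc i) + ∑[ i < N ] (w (suc i) zero * (b zero * μ))
      ≡⟨ cong (_+_ (∑[ i < N ] b (suc i)))
           (trans (∑-*ʳ N (b zero * μ) (λ i → w (suc i) zero)) (cong (_* (b zero * μ)) (sum-cong-≗ (λ i → w-sym (suc i) zero)))) ⟩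
        ∑[ i < N ] b (suc i) + D * (b zero * μ)
      ≡⟨ cong (_+_ (∑[ i < N ] b (suc i))) (trans (solve 3 (λ d b m → d :* (b :* m) := b :* (d :* m)) refl D (b zero) μ)
            (trans (cong (b zero *_) Dμ≡1) (QP.*-identityʳ (b zero)))) ⟩
        ∑[ i < N ] b (suc i) + b zero
      ≡⟨ trans (QP.+-comm (∑[ i < N ] b (suc i)) (b zero)) ∑b≡0 ⟩
        0ℚ ∎
      where open ≡-Reasoning

    module _ (x′ : Fin N → ℚ) (x′-solves : ∀ i → laplacian w′ x′ i ≡ b′ i) where
      Sx′ : ℚ
      Sx′ = ∑[ j < N ] (w zero (suc j) * x′ j)

      extended : Fin (suc N) → ℚ
      extended zero    = (b zero + Sx′) * μ
      extended (suc i) = x′ i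

      ∑w₀ⱼ[y-x′ⱼ] : ∀ y → ∑[ j < N ] (w zero (suc j) * (y - x′ j)) ≡ D * y - Sx′
      ∑w₀ⱼ[y-x′ⱼ] y = begin
          ∑[ j < N ] (w zero (suc j) * (y - x′ j))
        ≡⟨ sum-cong-≗ (λ j → solve 3 (λ a y z → a :* (y :- z) := a :* y :- a :* z) refl (w zero (suc j)) y (x′ j)) ⟩
          ∑[ j < N ] (w zero (suc j) * y - w zero (suc j) * x′ j)
        ≡⟨ ∑-distrib-- N (λ j → w zero (suc j) * y) (λ j → w zero (suc j) * x′ j) ⟩
          ∑[ j < N ] (w zero (suc j) * y) - Sx′
        ≡⟨ cong (_- Sx′) (∑-*ʳ N y (λ j → w zero (suc j))) ⟩
          D * y - Sx′ ∎
        where open ≡-Reasoning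

      extended-solves-at-zero : laplacian w extended zero ≡ b zero
      extended-solves-at-zero = begin
          w zero zero * (extended zero - extended zero) + ∑[ j < N ] (w zero (suc j) * (extended zero - x′ j))
        ≡⟨ cong₂ _+_ (trans (cong (w zero zero *_) (QP.+-inverseʳ (extended zero))) (QP.*-zeroʳ (w zero zero))) (∑w₀ⱼ[y-x′ⱼ] (extended zero)) ⟩
          0ℚ + (D * ((b zero + Sx′) * μ) - Sx′)
        ≡⟨ solve 4 (λ d b s m → con 0ℚ :+ (d :* ((b :+ s) :* m) :- s) := (b :+ s) :* (d :* m) :- s) refl D (b zero) Sx′ μ ⟩
          (b zero + Sx′) * (D * μ) - Sx′
        ≡⟨ cong (λ t → (b zero + Sx′) * t - Sx′) Dμ≡1 ⟩
          (b zero + Sx′) * 1ℚ - Sx′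
        ≡⟨ solve 2 (λ b s → (b :+ s) :* con 1ℚ :- s := b) refl (b zero) Sx′ ⟩
          b zero ∎
        where open ≡-Reasoning

      extended-solves-at-suc : ∀ i → laplacian w extended (suc i) ≡ b (suc i)
      extended-solves-at-suc i = begin
          w (suc i) zero * (x′ i - extended zero) + A
        ≡⟨ solve 8 (λ a0 xi b0 s m d a bb → a0 :* (xi :- (b0 :+ s) :* m) :+ a
               := ((a :+ a0 :* m :* (d :* xi :- s)) :- (bb :+ a0 :* (b0 :* m))) :+ bb :+ a0 :* xi :* (con 1ℚ :- d :* m)) refl
               (w (suc i) zero) (x′ i) (b zero) Sx′ μ D A (b (suc i)) ⟩
          ((A + w (suc i) zero * μ * (D * x′ i - Sx′)) - b′ i) + b (suc i) + w (suc i) zero * x′ i * (1ℚ - D * μ)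
        ≡⟨ cong₂ (λ p q → (p - b′ i) + b (suc i) + w (suc i) zero * x′ i * (1ℚ - q)) (sym reduced-laplacian) Dμ≡1 ⟩
          (laplacian w′ x′ i - b′ i) + b (suc i) + w (suc i) zero * x′ i * (1ℚ - 1ℚ)
        ≡⟨ cong (λ p → (p - b′ i) + b (suc i) + w (suc i) zero * x′ i * (1ℚ - 1ℚ)) (x′-solves i) ⟩
          (b′ i - b′ i) + b (suc i) + w (suc i) zero * x′ i * (1ℚ - 1ℚ)
        ≡⟨ solve 3 (λ p bb q → (p :- p) :+ bb :+ q :* (con 1ℚ :- con 1ℚ) := bb) refl (b′ i) (b (suc i)) (w (suc i) zero * x′ i) ⟩
          b (suc i) ∎
        where
        open ≡-Reasoning
        A : ℚ
        A = ∑[ j < N ] (w (suc i) (suc j) * (x′ i - x′ j))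
        reduced-laplacian : laplacian w′ x′ i ≡ A + w (suc i) zero * μ * (D * x′ i - Sx′)
        reduced-laplacian = begin
            ∑[ j < N ] (w′ i j * (x′ i - x′ j))
          ≡⟨ sum-cong-≗ (λ j → solve 5 (λ a b c m y → (a :+ b :* c :* m) :* y := a :* y :+ (b :* m) :* (c :* y)) refl
                (w (suc i) (suc j)) (w (suc i) zero) (w zero (suc j)) μ (x′ i - x′ j)) ⟩
            ∑[ j < N ] (w (suc i) (suc j) * (x′ i - x′ j) + (w (suc i) zero * μ) * (w zero (suc j) * (x′ i - x′ j)))
          ≡⟨ ∑-distrib-+ (λ j → w (suc i) (suc j) * (x′ i - x′ j)) (λ j → (w (suc i) zero * μ) * (w zero (suc j) * (x′ i - x′ j))) ⟩
            A + ∑[ j < N ] ((w (suc i) zero * μ) * (w zero (suc j) * (x′ i - x′ j)))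
          ≡⟨ cong (_+_ A) (trans (∑-*ˡ N (w (suc i) zero * μ) (λ j → w zero (suc j) * (x′ i - x′ j)))
                                 (cong (w (suc i) zero * μ *_) (∑w₀ⱼ[y-x′ⱼ] (x′ i)))) ⟩
            A + w (suc i) zero * μ * (D * x′ i - Sx′) ∎

      extended-solves : ∀ i → laplacian w extended i ≡ b i
      extended-solves zero    = extended-solves-at-zero
      extended-solves (suc i) = extended-solves-at-suc i

poisson-solvable : ∀ n → PoissonSolvable n
poisson-solvable zero          net b ∑b≡0 = (λ ()) , (λ ())
poisson-solvable (suc zero)    net b ∑b≡0 = (λ _ → 0ℚ) , λ { zero →
  trans (cong (_+ 0ℚ) (QP.*-zeroʳ (ConnectedNetwork.w net zero zero))) (sym (trans (sym (QP.+-identityʳ (b zero))) ∑b≡0)) }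
poisson-solvable (suc (suc N)) net b ∑b≡0 =
  let (x′ , x′-solves) = poisson-solvable (suc N) reduced (b′ b) (b′-balanced b ∑b≡0)
  in extended b x′ x′-solves , extended-solves b x′ x′-solves
  where open KronReduction net zero

module AdjacencyNetwork (H : Graph) (connected : Connected H) where
  open EdgeSums H

  edgeWeight : Fin m → Fin n → Fin n → ℚ
  edgeWeight t i j = [ u t ≟ i ] * [ v t ≟ j ] + [ v t ≟ i ] * [ u t ≟ j ]

  edgeWeight-nonNeg : ∀ t i j → 0ℚ ≤ edgeWeight t i j
  edgeWeight-nonNeg t i j = QP.+-mono-≤ (*-nonNeg (δ-nonNeg (u t) i) (δ-nonNeg (v t) j))
                                         (*-nonNeg (δ-nonNeg (v t) i) (δ-nonNeg (u t) j))

  adjacency : Weights n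
  adjacency i j = ∑[ t < m ] edgeWeight t i j

  adjacency-pos : ∀ {i j} → Adj H i j → 0ℚ < adjacency i j
  adjacency-pos {i} {j} (t , ends) = QP.<-≤-trans (edge-pos ends) (term≤∑ m (λ t → edgeWeight t i j) (λ t → edgeWeight-nonNeg t i j) t)
    where
    0<1 : 0ℚ < 1ℚ
    0<1 = QP.positive⁻¹ 1ℚ
    edge-pos : (u t ≡ i × v t ≡ j) ⊎ (u t ≡ j × v t ≡ i) → 0ℚ < edgeWeight t i j
    edge-pos (inj₁ (refl , refl)) = QP.+-mono-<-≤ (subst (0ℚ <_) (sym (cong₂ _*_ (δ-refl (u t)) (δ-refl (v t)))) 0<1)
                                                  (*-nonNeg (δ-nonNeg (v t) i) (δ-nonNeg (u t) j))
    edge-pos (inj₂ (refl , refl)) = QP.+-mono-≤-< (*-nonNeg (δ-nonNeg (u t) i) (δ-nonNeg (v t) j))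
                                                  (subst (0ℚ <_) (sym (cong₂ _*_ (δ-refl (v t)) (δ-refl (u t)))) 0<1)

  reach⇒linked : ∀ {i j} → Reach H i j → Linked adjacency i j
  reach⇒linked here         = here
  reach⇒linked (step a r)   = step (adjacency-pos a) (reach⇒linked r)

  network : ConnectedNetwork n
  network = record
    { w        = adjacency
    ; w-sym    = λ i j → sum-cong-≗ (λ t → solve 4 (λ a b c d → a :* b :+ c :* d := d :* c :+ b :* a) refl
                           [ u t ≟ i ] [ v t ≟ j ] [ v t ≟ i ] [ u t ≟ j ])
    ; w-nonNeg = λ i j → ∑-nonNeg m (λ t → edgeWeight t i j) (λ t → edgeWeight-nonNeg t i j)
    ; linked   = λ i j → reach⇒linked (connected i j)
    }

  laplacian≡outflow : ∀ x i → laplacian adjacency x i ≡ outflow H x i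
  laplacian≡outflow x i = begin
      ∑[ j < n ] (adjacency i j * (x i - x j))
    ≡⟨ sum-cong-≗ (λ j → sym (∑-*ʳ m (x i - x j) (λ t → edgeWeight t i j))) ⟩
      ∑[ j < n ] ∑[ t < m ] (edgeWeight t i j * (x i - x j))
    ≡⟨ ∑-comm (λ j t → edgeWeight t i j * (x i - x j)) ⟩
      ∑[ t < m ] ∑[ j < n ] (edgeWeight t i j * (x i - x j))
    ≡⟨ sum-cong-≗ (λ t → trans (sum-cong-≗ (λ j → solve 5 (λ a b c d y → (a :* b :+ c :* d) :* y := b :* (a :* y) :+ d :* (c :* y)) refl
          [ u t ≟ i ] [ v t ≟ j ] [ v t ≟ i ] [ u t ≟ j ] (x i - x j)))
          (∑-δ₂ (v t) (u t) (λ j → [ u t ≟ i ] * (x i - x j)) (λ j → [ v t ≟ i ] * (x i - x j)))) ⟩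
      ∑[ t < m ] ([ u t ≟ i ] * (x i - x (v t)) + [ v t ≟ i ] * (x i - x (u t)))
    ≡⟨ sum-cong-≗ (λ t → sym (cong₂ _+_ (δ-*-transport (λ k → x k - x (v t)) (u t) i) (δ-*-transport (λ k → x k - x (u t)) (v t) i))) ⟩
      ∑[ t < m ] edgeOutflow x i t
    ≡⟨ sym (outflow≡∑ x i) ⟩
      outflow H x i ∎
    where open ≡-Reasoning

outflow-solvable : ∀ H → Connected H → (b : Fin (nV H) → ℚ) → ∑[ i < nV H ] b i ≡ 0ℚ →
  Σ (Fin (nV H) → ℚ) λ x → ∀ i → outflow H x i ≡ b i
outflow-solvable H connected b ∑b≡0 =
  let (x , x-solves) = poisson-solvable (nV H) network b ∑b≡0
  in x , λ i → trans (sym (laplacian≡outflow x i)) (x-solves i)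
  where open AdjacencyNetwork H connected

-- Green functions and effective resistance

record Green (H : Graph) : Set where
  field
    κ            : ℚ
    κ-normalises : ℕtoℚ (nE H) * two * κ ≡ 1ℚ
    g            : Fin (nV H) → Fin (nV H) → ℚ
    g-source     : ∀ c i → outflow H (g c) i ≡ [ i ≟ c ] - degree H i * κ
    g-centred    : ∀ c → ∑[ i < nV H ] (degree H i * g c i) ≡ 0ℚ

edge-exists : ∀ H → Connected H → nV H ≥ 2 → Fin (nE H)
edge-exists H connected n≥2 = first-edge (connected v₀ v₁) v₀≢v₁
  where
  v₀ v₁ : Fin (nV H)
  v₀ = F.fromℕ< (ℕP.≤-trans (ℕ.s≤s ℕ.z≤n) n≥2)
  v₁ = F.fromℕ< n≥2
  v₀≢v₁ : v₀ ≢ v₁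
  v₀≢v₁ v₀≡v₁ with trans (sym (FP.toℕ-fromℕ< _)) (trans (cong F.toℕ v₀≡v₁) (FP.toℕ-fromℕ< n≥2))
  ... | ()
  first-edge : ∀ {i j} → Reach H i j → i ≢ j → Fin (nE H)
  first-edge here         i≢i = ⊥-elim (i≢i refl)
  first-edge (step (t , _) _) _ = t

green-exists : ∀ H → Connected H → nV H ≥ 2 → Green H
green-exists H connected n≥2 = record
  { κ = κ ; κ-normalises = 2mκ≡1 ; g = g ; g-source = g-source ; g-centred = g-centred }
  where
  open EdgeSums H
  2m-pos : 0ℚ < ℕtoℚ m * two
  2m-pos = *-pos (ℕtoℚ-pos (edge-exists H connected n≥2)) (QP.positive⁻¹ two)
  instance
    2m≢0 : Q.NonZero (ℕtoℚ m * two)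
    2m≢0 = QP.pos⇒nonZero (ℕtoℚ m * two) {{Q.positive 2m-pos}}
  κ : ℚ
  κ = Q.1/ (ℕtoℚ m * two)
  2mκ≡1 : ℕtoℚ m * two * κ ≡ 1ℚ
  2mκ≡1 = QP.*-inverseʳ (ℕtoℚ m * two)

  ∑-degree*κ : ∑[ i < n ] (degree H i * κ) ≡ 1ℚ
  ∑-degree*κ = trans (∑-*ʳ n κ (degree H)) (trans (cong (_* κ) ∑-degree) 2mκ≡1)

  source : Fin n → Fin n → ℚ
  source c i = [ i ≟ c ] - degree H i * κ
  source-balanced : ∀ c → ∑[ i < n ] source c i ≡ 0ℚ
  source-balanced c = begin
      ∑[ i < n ] ([ i ≟ c ] - degree H i * κ)             ≡⟨ ∑-distrib-- n (λ i → [ i ≟ c ]) (λ i → degree H i * κ) ⟩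
      ∑[ i < n ] [ i ≟ c ] - ∑[ i < n ] (degree H i * κ)  ≡⟨ cong₂ _-_ (∑-δ n c) ∑-degree*κ ⟩
      1ℚ - 1ℚ                                              ≡⟨ QP.+-inverseʳ 1ℚ ⟩
      0ℚ                                                   ∎
    where open ≡-Reasoning

  x : Fin n → Fin n → ℚ
  x c = proj₁ (outflow-solvable H connected (source c) (source-balanced c))
  mean : Fin n → ℚ
  mean c = ∑[ i < n ] (degree H i * x c i)
  g : Fin n → Fin n → ℚ
  g c i = x c i - mean c * κ

  g-source : ∀ c i → outflow H (g c) i ≡ source c i
  g-source c i = begin
      outflow H (g c) i
    ≡⟨ outflow-cong (λ j → solve 2 (λ a s → a :- s := con 1ℚ :* a :+ con 0ℚ :* a :+ (:- s)) refl (x c j) (mean c * κ)) i ⟩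
      outflow H (λ j → 1ℚ * x c j + 0ℚ * x c j + (- (mean c * κ))) i
    ≡⟨ outflow-affine 1ℚ 0ℚ (- (mean c * κ)) (x c) (x c) i ⟩
      1ℚ * outflow H (x c) i + 0ℚ * outflow H (x c) i
    ≡⟨ solve 1 (λ o → con 1ℚ :* o :+ con 0ℚ :* o := o) refl (outflow H (x c) i) ⟩
      outflow H (x c) i
    ≡⟨ proj₂ (outflow-solvable H connected (source c) (source-balanced c)) i ⟩
      source c i ∎
    where open ≡-Reasoning

  g-centred : ∀ c → ∑[ i < n ] (degree H i * g c i) ≡ 0ℚ
  g-centred c = begin
      ∑[ i < n ] (degree H i * (x c i - mean c * κ))
    ≡⟨ sum-cong-≗ (λ i → solve 4 (λ d a s k → d :* (a :- s :* k) := d :* a :- s :* (d :* k)) refl (degree H i) (x c i) (mean c) κ) ⟩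
      ∑[ i < n ] (degree H i * x c i - mean c * (degree H i * κ))
    ≡⟨ ∑-distrib-- n (λ i → degree H i * x c i) (λ i → mean c * (degree H i * κ)) ⟩
      mean c - ∑[ i < n ] (mean c * (degree H i * κ))
    ≡⟨ cong (_-_ (mean c)) (trans (∑-*ˡ n (mean c) (λ i → degree H i * κ)) (trans (cong (mean c *_) ∑-degree*κ) (QP.*-identityʳ (mean c)))) ⟩
      mean c - mean c
    ≡⟨ QP.+-inverseʳ (mean c) ⟩
      0ℚ ∎
    where open ≡-Reasoning

module DegreeWeighted (H : Graph) where
  open EdgeSums H

  weighted : (Fin n → Fin n → ℚ) → ℚ
  weighted F = ∑[ i < n ] ∑[ j < n ] (degree H i * degree H j * F i j)

  weighted-−−+ : ∀ F G K L →
    weighted (λ i j → F i j - G i j - K i j + L i j) ≡ weighted F - weighted G - weighted K + weighted L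
  weighted-−−+ F G K L = begin
      weighted (λ i j → F i j - G i j - K i j + L i j)
    ≡⟨ sum-cong-≗ (λ i → trans (sum-cong-≗ (λ j → solve 6 (λ d d′ f g k l → d :* d′ :* (f :- g :- k :+ l)
                                := d :* d′ :* f :- d :* d′ :* g :- d :* d′ :* k :+ d :* d′ :* l) refl
                                (degree H i) (degree H j) (F i j) (G i j) (K i j) (L i j)))
                              (∑-distrib-−−+ n (term F i) (term G i) (term K i) (term L i))) ⟩
      ∑[ i < n ] (∑[ j < n ] term F i j - ∑[ j < n ] term G i j - ∑[ j < n ] term K i j + ∑[ j < n ] term L i j)
    ≡⟨ ∑-distrib-−−+ n (λ i → ∑[ j < n ] term F i j) (λ i → ∑[ j < n ] term G i j) (λ i → ∑[ j < n ] term K i j) (λ i → ∑[ j < n ] term L i j) ⟩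
      weighted F - weighted G - weighted K + weighted L ∎
    where
    open ≡-Reasoning
    term : (Fin n → Fin n → ℚ) → Fin n → Fin n → ℚ
    term F i j = degree H i * degree H j * F i j

  weighted-flip : ∀ F → weighted F ≡ weighted (λ i j → F j i)
  weighted-flip F = trans (∑-comm (λ i j → degree H i * degree H j * F i j))
    (sum-cong-≗ (λ j → sum-cong-≗ (λ i → cong (_* F i j) (QP.*-comm (degree H i) (degree H j)))))

  weighted-row : ∀ (F : Fin n → ℚ) → weighted (λ i j → F i) ≡ ℕtoℚ m * two * ∑[ i < n ] (degree H i * F i)
  weighted-row F = begin
      ∑[ i < n ] ∑[ j < n ] (degree H i * degree H j * F i)
    ≡⟨ sum-cong-≗ (λ i → trans (sum-cong-≗ (λ j → solve 3 (λ d d′ f → d :* d′ :* f := d′ :* (d :* f)) refl (degree H i) (degree H j) (F i)))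
                              (trans (∑-*ʳ n (degree H i * F i) (degree H)) (cong (_* (degree H i * F i)) ∑-degree))) ⟩
      ∑[ i < n ] (ℕtoℚ m * two * (degree H i * F i))
    ≡⟨ ∑-*ˡ n (ℕtoℚ m * two) (λ i → degree H i * F i) ⟩
      ℕtoℚ m * two * ∑[ i < n ] (degree H i * F i) ∎
    where open ≡-Reasoning

  weighted-centred : ∀ F → (∀ i → ∑[ j < n ] (degree H j * F i j) ≡ 0ℚ) → weighted F ≡ 0ℚ
  weighted-centred F centred = begin
      ∑[ i < n ] ∑[ j < n ] (degree H i * degree H j * F i j)
    ≡⟨ sum-cong-≗ (λ i → trans (sum-cong-≗ (λ j → QP.*-assoc (degree H i) (degree H j) (F i j)))
                              (trans (∑-*ˡ n (degree H i) (λ j → degree H j * F i j)) (trans (cong (degree H i *_) (centred i)) (QP.*-zeroʳ (degree H i))))) ⟩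
      ∑[ i < n ] 0ℚ
    ≡⟨ sum-replicate-zero n ⟩
      0ℚ ∎
    where open ≡-Reasoning

trace : ∀ {H} → Green H → ℚ
trace {H} G = ∑[ c < nV H ] (degree H c * Green.g G c c)

module GreenResistance (H : Graph) (connected : Connected H) (G : Green H) where
  open Green G
  open EdgeSums H
  open DegreeWeighted H

  Ω : Fin n → Fin n → ℚ
  Ω a b = g a a - g a b - g b a + g b b

  potential : Fin n → Fin n → Fin n → ℚ
  potential a b i = g a i - g b i

  potential-outflow : ∀ a b i → outflow H (potential a b) i ≡ [ i ≟ a ] - [ i ≟ b ]
  potential-outflow a b i = begin
      outflow H (potential a b) i
    ≡⟨ outflow-cong (λ j → solve 2 (λ x y → x :- y := con 1ℚ :* x :+ (:- con 1ℚ) :* y :+ con 0ℚ) refl (g a j) (g b j)) i ⟩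
      outflow H (λ j → 1ℚ * g a j + (- 1ℚ) * g b j + 0ℚ) i
    ≡⟨ outflow-affine 1ℚ (- 1ℚ) 0ℚ (g a) (g b) i ⟩
      1ℚ * outflow H (g a) i + (- 1ℚ) * outflow H (g b) i
    ≡⟨ cong₂ (λ p q → 1ℚ * p + (- 1ℚ) * q) (g-source a i) (g-source b i) ⟩
      1ℚ * ([ i ≟ a ] - degree H i * κ) + (- 1ℚ) * ([ i ≟ b ] - degree H i * κ)
    ≡⟨ solve 4 (λ p q d k → con 1ℚ :* (p :- d :* k) :+ (:- con 1ℚ) :* (q :- d :* k) := p :- q) refl
         [ i ≟ a ] [ i ≟ b ] (degree H i) κ ⟩
      [ i ≟ a ] - [ i ≟ b ] ∎
    where open ≡-Reasoning

  Ω-isResistance : ∀ a b → IsResistance H a b (Ω a b)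
  Ω-isResistance a b = potential a b , potential-outflow a b ,
    solve 4 (λ aa ab ba bb → aa :- ab :- ba :+ bb := (aa :- ba) :- (ab :- bb)) refl (g a a) (g a b) (g b a) (g b b)

  resistance-unique : ∀ {a b ω} → IsResistance H a b ω → ω ≡ Ω a b
  resistance-unique {a} {b} {ω} (y , y-outflow , ω≡ya-yb) = begin
      ω
    ≡⟨ ω≡ya-yb ⟩
      y a - y b
    ≡⟨ solve 4 (λ ya yb xa xb → ya :- yb := (ya :- xa) :- (yb :- xb) :+ (xa :- xb)) refl (y a) (y b) (potential a b a) (potential a b b) ⟩
      z a - z b + (potential a b a - potential a b b)
    ≡⟨ cong (λ t → t - z b + (potential a b a - potential a b b)) (harmonic-constant H connected z z-harmonic a b) ⟩
      z b - z b + (potential a b a - potential a b b)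
    ≡⟨ solve 2 (λ zb p → zb :- zb :+ p := p) refl (z b) (potential a b a - potential a b b) ⟩
      potential a b a - potential a b b
    ≡⟨ sym (proj₂ (proj₂ (Ω-isResistance a b))) ⟩
      Ω a b ∎
    where
    open ≡-Reasoning
    z : Fin n → ℚ
    z i = y i - potential a b i
    z-harmonic : ∀ i → outflow H z i ≡ 0ℚ
    z-harmonic i = begin
        outflow H z i
      ≡⟨ outflow-cong (λ j → solve 2 (λ x y → x :- y := con 1ℚ :* x :+ (:- con 1ℚ) :* y :+ con 0ℚ) refl (y j) (potential a b j)) i ⟩
        outflow H (λ j → 1ℚ * y j + (- 1ℚ) * potential a b j + 0ℚ) i
      ≡⟨ outflow-affine 1ℚ (- 1ℚ) 0ℚ y (potential a b) i ⟩
        1ℚ * outflow H y i + (- 1ℚ) * outflow H (potential a b) i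
      ≡⟨ cong₂ (λ p q → 1ℚ * p + (- 1ℚ) * q) (y-outflow i) (potential-outflow a b i) ⟩
        1ℚ * ([ i ≟ a ] - [ i ≟ b ]) + (- 1ℚ) * ([ i ≟ a ] - [ i ≟ b ])
      ≡⟨ solve 1 (λ p → con 1ℚ :* p :+ (:- con 1ℚ) :* p := con 0ℚ) refl ([ i ≟ a ] - [ i ≟ b ]) ⟩
        0ℚ ∎

  -- With g centred, only the diagonal terms g a a + g b b of Ω survive the degree-weighted sum.
  weighted-Ω : weighted Ω ≡ ℕtoℚ m * two * trace G + ℕtoℚ m * two * trace G
  weighted-Ω = begin
      weighted Ω
    ≡⟨ weighted-−−+ (λ a b → g a a) g (λ a b → g b a) (λ a b → g b b) ⟩
      weighted (λ a b → g a a) - weighted g - weighted (λ a b → g b a) + weighted (λ a b → g b b)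
    ≡⟨ cong₂ (λ p q → weighted (λ a b → g a a) - weighted g - p + q) (sym (weighted-flip g)) (weighted-flip (λ a b → g b b)) ⟩
      weighted (λ a b → g a a) - weighted g - weighted g + weighted (λ a b → g a a)
    ≡⟨ cong₂ (λ p q → p - q - q + p) (weighted-row (λ a → g a a)) (weighted-centred g g-centred) ⟩
      ℕtoℚ m * two * trace G - 0ℚ - 0ℚ + ℕtoℚ m * two * trace G
    ≡⟨ solve 1 (λ t → t :- con 0ℚ :- con 0ℚ :+ t := t :+ t) refl (ℕtoℚ m * two * trace G) ⟩
      ℕtoℚ m * two * trace G + ℕtoℚ m * two * trace G ∎
    where open ≡-Reasoning

  kirchhoff≡2m*trace : sumPairs n (λ i j → degree H i * degree H j * Ω i j) ≡ ℕtoℚ m * two * trace G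
  kirchhoff≡2m*trace = x+x≡y+y⇒x≡y (trans (sym (∑∑≡sumPairs+sumPairs n _ Ω-sym Ω-diagonal)) weighted-Ω)
    where
    Ω-sym : ∀ i j → degree H i * degree H j * Ω i j ≡ degree H j * degree H i * Ω j i
    Ω-sym i j = solve 6 (λ di dj gii gij gji gjj → di :* dj :* (gii :- gij :- gji :+ gjj) := dj :* di :* (gjj :- gji :- gij :+ gii)) refl
                  (degree H i) (degree H j) (g i i) (g i j) (g j i) (g j j)
    Ω-diagonal : ∀ i → degree H i * degree H i * Ω i i ≡ 0ℚ
    Ω-diagonal i = solve 2 (λ d x → d :* d :* (x :- x :- x :+ x) := con 0ℚ) refl (degree H i) (g i i)

  IsRStar-2m*trace : IsRStar H (ℕtoℚ m * two * trace G)
  IsRStar-2m*trace = Ω , (λ i j → Ω-isResistance i j) , sym kirchhoff≡2m*trace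

  IsRStar⇒≡2m*trace : ∀ {r} → IsRStar H r → r ≡ ℕtoℚ m * two * trace G
  IsRStar⇒≡2m*trace {r} (Ω′ , Ω′-isResistance , r≡) = begin
      r                                                   ≡⟨ r≡ ⟩
      sumPairs n (λ i j → degree H i * degree H j * Ω′ i j) ≡⟨ sumPairs-cong n (λ i j → cong (degree H i * degree H j *_) (resistance-unique (Ω′-isResistance i j))) ⟩
      sumPairs n (λ i j → degree H i * degree H j * Ω i j)  ≡⟨ kirchhoff≡2m*trace ⟩
      ℕtoℚ m * two * trace G                                ∎
    where open ≡-Reasoning

-- Subdivision

module Subdivision (H : Graph) where
  open EdgeSums H

  original : Fin n → Fin (nV (S H))
  original i = i ↑ˡ m

  midpoint : Fin m → Fin (nV (S H))
  midpoint t = n ↑ʳ t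

  data Vertex : Fin (nV (S H)) → Set where
    original-vertex : ∀ i → Vertex (original i)
    midpoint-vertex : ∀ t → Vertex (midpoint t)

  classify : ∀ z → Vertex z
  classify z with splitAt n z in eq
  ... | inj₁ i = subst Vertex (FP.splitAt⁻¹-↑ˡ eq) (original-vertex i)
  ... | inj₂ t = subst Vertex (FP.splitAt⁻¹-↑ʳ eq) (midpoint-vertex t)

  endpoints-first-half : ∀ t → endpoints (S H) (t ↑ˡ m) ≡ (original (u t) , midpoint t)
  endpoints-first-half t = trans (VP.lookup-++ˡ (V.tabulate λ t → original (u t) , midpoint t) (V.tabulate λ t → original (v t) , midpoint t) t)
                                 (VP.lookup∘tabulate (λ t → original (u t) , midpoint t) t)

  endpoints-second-half : ∀ t → endpoints (S H) (m ↑ʳ t) ≡ (original (v t) , midpoint t)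
  endpoints-second-half t = trans (VP.lookup-++ʳ (V.tabulate λ t → original (u t) , midpoint t) (V.tabulate λ t → original (v t) , midpoint t) t)
                                  (VP.lookup∘tabulate (λ t → original (v t) , midpoint t) t)

  ∑-edges : ∀ (F : Fin (nV (S H)) → Fin (nV (S H)) → ℚ) →
    ∑[ s < nE (S H) ] F (proj₁ (endpoints (S H) s)) (proj₂ (endpoints (S H) s))
      ≡ ∑[ t < m ] F (original (u t)) (midpoint t) + ∑[ t < m ] F (original (v t)) (midpoint t)
  ∑-edges F = trans (∑-↑ m m (λ s → F (proj₁ (endpoints (S H) s)) (proj₂ (endpoints (S H) s))))
    (cong₂ _+_ (sum-cong-≗ (λ t → cong₂ F (cong proj₁ (endpoints-first-half t)) (cong proj₂ (endpoints-first-half t))))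
               (sum-cong-≗ (λ t → cong₂ F (cong proj₁ (endpoints-second-half t)) (cong proj₂ (endpoints-second-half t)))))

  ∑-vertices : ∀ (f : Fin (nV (S H)) → ℚ) → ∑[ z < nV (S H) ] f z ≡ ∑[ i < n ] f (original i) + ∑[ t < m ] f (midpoint t)
  ∑-vertices = ∑-↑ n m

  original≢midpoint : ∀ i t → original i ≢ midpoint t
  original≢midpoint i t eq with trans (sym (FP.splitAt-↑ˡ n i m)) (trans (cong (splitAt n) eq) (FP.splitAt-↑ʳ n m t))
  ... | ()

  δ-original : ∀ i j → [ original i ≟ original j ] ≡ [ i ≟ j ]
  δ-original = δ-injective original (FP.↑ˡ-injective m _ _)

  δ-midpoint : ∀ t t′ → [ midpoint t ≟ midpoint t′ ] ≡ [ t ≟ t′ ]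
  δ-midpoint = δ-injective midpoint (FP.↑ʳ-injective n _ _)

  δ-original-midpoint : ∀ i t → [ original i ≟ midpoint t ] ≡ 0ℚ
  δ-original-midpoint i t = δ-≢ (original≢midpoint i t)

  δ-midpoint-original : ∀ t i → [ midpoint t ≟ original i ] ≡ 0ℚ
  δ-midpoint-original t i = δ-≢ (λ eq → original≢midpoint i t (sym eq))

  degree-original : ∀ i → degree (S H) (original i) ≡ degree H i
  degree-original i = begin
      degree (S H) (original i)
    ≡⟨ EdgeSums.degree≡∑ (S H) (original i) ⟩
      ∑[ s < nE (S H) ] ([ proj₁ (endpoints (S H) s) ≟ original i ] + [ proj₂ (endpoints (S H) s) ≟ original i ])
    ≡⟨ ∑-edges (λ a b → [ a ≟ original i ] + [ b ≟ original i ]) ⟩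
      ∑[ t < m ] ([ original (u t) ≟ original i ] + [ midpoint t ≟ original i ])
        + ∑[ t < m ] ([ original (v t) ≟ original i ] + [ midpoint t ≟ original i ])
    ≡⟨ cong₂ _+_ (sum-cong-≗ (λ t → trans (cong₂ _+_ (δ-original (u t) i) (δ-midpoint-original t i)) (QP.+-identityʳ _)))
                 (sum-cong-≗ (λ t → trans (cong₂ _+_ (δ-original (v t) i) (δ-midpoint-original t i)) (QP.+-identityʳ _))) ⟩
      ∑[ t < m ] [ u t ≟ i ] + ∑[ t < m ] [ v t ≟ i ]
    ≡⟨ sym (trans (degree≡∑ i) (∑-distrib-+ (λ t → [ u t ≟ i ]) (λ t → [ v t ≟ i ]))) ⟩
      degree H i ∎
    where open ≡-Reasoning

  degree-midpoint : ∀ t → degree (S H) (midpoint t) ≡ two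
  degree-midpoint t₀ = begin
      degree (S H) (midpoint t₀)
    ≡⟨ EdgeSums.degree≡∑ (S H) (midpoint t₀) ⟩
      ∑[ s < nE (S H) ] ([ proj₁ (endpoints (S H) s) ≟ midpoint t₀ ] + [ proj₂ (endpoints (S H) s) ≟ midpoint t₀ ])
    ≡⟨ ∑-edges (λ a b → [ a ≟ midpoint t₀ ] + [ b ≟ midpoint t₀ ]) ⟩
      ∑[ t < m ] ([ original (u t) ≟ midpoint t₀ ] + [ midpoint t ≟ midpoint t₀ ])
        + ∑[ t < m ] ([ original (v t) ≟ midpoint t₀ ] + [ midpoint t ≟ midpoint t₀ ])
    ≡⟨ cong₂ _+_ (sum-cong-≗ (λ t → trans (cong₂ _+_ (δ-original-midpoint (u t) t₀) (δ-midpoint t t₀)) (QP.+-identityˡ _)))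
                 (sum-cong-≗ (λ t → trans (cong₂ _+_ (δ-original-midpoint (v t) t₀) (δ-midpoint t t₀)) (QP.+-identityˡ _))) ⟩
      ∑[ t < m ] [ t ≟ t₀ ] + ∑[ t < m ] [ t ≟ t₀ ]
    ≡⟨ cong₂ _+_ (∑-δ m t₀) (∑-δ m t₀) ⟩
      two ∎
    where open ≡-Reasoning

  outflow-original : ∀ (x : Fin (nV (S H)) → ℚ) i → outflow (S H) x (original i)
    ≡ ∑[ t < m ] ([ u t ≟ i ] * (x (original (u t)) - x (midpoint t)) + [ v t ≟ i ] * (x (original (v t)) - x (midpoint t)))
  outflow-original x i = begin
      outflow (S H) x (original i)
    ≡⟨ EdgeSums.outflow≡∑ (S H) x (original i) ⟩
      ∑[ s < nE (S H) ] (flow (proj₁ (endpoints (S H) s)) (proj₂ (endpoints (S H) s)))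
    ≡⟨ ∑-edges flow ⟩
      ∑[ t < m ] flow (original (u t)) (midpoint t) + ∑[ t < m ] flow (original (v t)) (midpoint t)
    ≡⟨ cong₂ _+_ (sum-cong-≗ (λ t → at (u t) t)) (sum-cong-≗ (λ t → at (v t) t)) ⟩
      ∑[ t < m ] ([ u t ≟ i ] * (x (original (u t)) - x (midpoint t))) + ∑[ t < m ] ([ v t ≟ i ] * (x (original (v t)) - x (midpoint t)))
    ≡⟨ sym (∑-distrib-+ (λ t → [ u t ≟ i ] * (x (original (u t)) - x (midpoint t))) (λ t → [ v t ≟ i ] * (x (original (v t)) - x (midpoint t)))) ⟩
      ∑[ t < m ] ([ u t ≟ i ] * (x (original (u t)) - x (midpoint t)) + [ v t ≟ i ] * (x (original (v t)) - x (midpoint t))) ∎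
    where
    open ≡-Reasoning
    flow : Fin (nV (S H)) → Fin (nV (S H)) → ℚ
    flow a b = [ a ≟ original i ] * (x a - x b) + [ b ≟ original i ] * (x b - x a)
    at : ∀ j t → flow (original j) (midpoint t) ≡ [ j ≟ i ] * (x (original j) - x (midpoint t))
    at j t = trans (cong₂ (λ p q → p * (x (original j) - x (midpoint t)) + q * (x (midpoint t) - x (original j))) (δ-original j i) (δ-midpoint-original t i))
                   (solve 3 (λ p a b → p :* (a :- b) :+ con 0ℚ :* (b :- a) := p :* (a :- b)) refl [ j ≟ i ] (x (original j)) (x (midpoint t)))

  outflow-midpoint : ∀ (x : Fin (nV (S H)) → ℚ) t → outflow (S H) x (midpoint t)
    ≡ (x (midpoint t) - x (original (u t))) + (x (midpoint t) - x (original (v t)))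
  outflow-midpoint x t₀ = begin
      outflow (S H) x (midpoint t₀)
    ≡⟨ EdgeSums.outflow≡∑ (S H) x (midpoint t₀) ⟩
      ∑[ s < nE (S H) ] (flow (proj₁ (endpoints (S H) s)) (proj₂ (endpoints (S H) s)))
    ≡⟨ ∑-edges flow ⟩
      ∑[ t < m ] flow (original (u t)) (midpoint t) + ∑[ t < m ] flow (original (v t)) (midpoint t)
    ≡⟨ cong₂ _+_ (sum-cong-≗ (λ t → at (u t) t)) (sum-cong-≗ (λ t → at (v t) t)) ⟩
      ∑[ t < m ] ([ t ≟ t₀ ] * (x (midpoint t) - x (original (u t)))) + ∑[ t < m ] ([ t ≟ t₀ ] * (x (midpoint t) - x (original (v t))))
    ≡⟨ cong₂ _+_ (∑-δʳ m t₀ (λ t → x (midpoint t) - x (original (u t)))) (∑-δʳ m t₀ (λ t → x (midpoint t) - x (original (v t)))) ⟩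
      (x (midpoint t₀) - x (original (u t₀))) + (x (midpoint t₀) - x (original (v t₀))) ∎
    where
    open ≡-Reasoning
    flow : Fin (nV (S H)) → Fin (nV (S H)) → ℚ
    flow a b = [ a ≟ midpoint t₀ ] * (x a - x b) + [ b ≟ midpoint t₀ ] * (x b - x a)
    at : ∀ j t → flow (original j) (midpoint t) ≡ [ t ≟ t₀ ] * (x (midpoint t) - x (original j))
    at j t = trans (cong₂ (λ p q → p * (x (original j) - x (midpoint t)) + q * (x (midpoint t) - x (original j))) (δ-original-midpoint j t₀) (δ-midpoint t t₀))
                   (solve 3 (λ p a b → con 0ℚ :* (b :- a) :+ p :* (a :- b) := p :* (a :- b)) refl [ t ≟ t₀ ] (x (midpoint t)) (x (original j)))

  original~midpoint-first : ∀ t → Adj (S H) (original (u t)) (midpoint t)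
  original~midpoint-first t = t ↑ˡ m , inj₁ (cong proj₁ (endpoints-first-half t) , cong proj₂ (endpoints-first-half t))

  original~midpoint-second : ∀ t → Adj (S H) (original (v t)) (midpoint t)
  original~midpoint-second t = m ↑ʳ t , inj₁ (cong proj₁ (endpoints-second-half t) , cong proj₂ (endpoints-second-half t))

  original-reach : ∀ {i j} → Reach H i j → Reach (S H) (original i) (original j)
  original-reach here = here
  original-reach (step (t , inj₁ (refl , refl)) r) =
    step (original~midpoint-first t) (step (adj-sym {S H} (original~midpoint-second t)) (original-reach r))
  original-reach (step (t , inj₂ (refl , refl)) r) =
    step (original~midpoint-second t) (step (adj-sym {S H} (original~midpoint-first t)) (original-reach r))

  anchor : ∀ {z} → Vertex z → Σ (Fin n) λ i → Reach (S H) z (original i) × Reach (S H) (original i) z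
  anchor (original-vertex i) = i , here , here
  anchor (midpoint-vertex t) = u t , step (adj-sym {S H} (original~midpoint-first t)) here , step (original~midpoint-first t) here

  subdivision-connected : Connected H → Connected (S H)
  subdivision-connected connected z z′ =
    let (i , z→i , _) = anchor (classify z)
        (j , _ , j→z′) = anchor (classify z′)
    in reach-++ z→i (reach-++ (original-reach (connected i j)) j→z′)

  incidence : Fin n → (Fin m → ℚ) → ℚ
  incidence i e = ∑[ t < m ] (([ u t ≟ i ] + [ v t ≟ i ]) * e t)

  incidence-const : ∀ i c → incidence i (λ _ → c) ≡ degree H i * c
  incidence-const i c = trans (∑-*ʳ m c (λ t → [ u t ≟ i ] + [ v t ≟ i ])) (cong (_* c) (sym (degree≡∑ i)))

  -- y is doubled on original vertices because each edge of H becomes two unit resistors in series.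
  lift : (Fin n → ℚ) → ℚ → (Fin m → ℚ) → Fin (nV (S H)) → ℚ
  lift y p e z = [ (λ i → two * y i + p) , (λ t → y (u t) + y (v t) + p + e t) ]′ (splitAt n z)

  lift-original : ∀ y p e i → lift y p e (original i) ≡ two * y i + p
  lift-original y p e i = cong [ (λ i → two * y i + p) , (λ t → y (u t) + y (v t) + p + e t) ]′ (FP.splitAt-↑ˡ n i m)

  lift-midpoint : ∀ y p e t → lift y p e (midpoint t) ≡ y (u t) + y (v t) + p + e t
  lift-midpoint y p e t = cong [ (λ i → two * y i + p) , (λ t → y (u t) + y (v t) + p + e t) ]′ (FP.splitAt-↑ʳ n m t)

  outflow-lift-original : ∀ y p e i → outflow (S H) (lift y p e) (original i) ≡ outflow H y i - incidence i e
  outflow-lift-original y p e i = begin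
      outflow (S H) (lift y p e) (original i)
    ≡⟨ outflow-original (lift y p e) i ⟩
      ∑[ t < m ] ([ u t ≟ i ] * (lift y p e (original (u t)) - lift y p e (midpoint t)) + [ v t ≟ i ] * (lift y p e (original (v t)) - lift y p e (midpoint t)))
    ≡⟨ sum-cong-≗ (λ t → trans (cong₂ (λ a b → [ u t ≟ i ] * (a - lift y p e (midpoint t)) + [ v t ≟ i ] * (b - lift y p e (midpoint t)))
                                     (lift-original y p e (u t)) (lift-original y p e (v t)))
                              (trans (cong (λ c → [ u t ≟ i ] * ((two * y (u t) + p) - c) + [ v t ≟ i ] * ((two * y (v t) + p) - c)) (lift-midpoint y p e t))
                                     (solve 6 (λ a b yu yv p e → a :* ((con two :* yu :+ p) :- (yu :+ yv :+ p :+ e)) :+ b :* ((con two :* yv :+ p) :- (yu :+ yv :+ p :+ e))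
                                                 := (a :* (yu :- yv) :+ b :* (yv :- yu)) :- (a :+ b) :* e) refl
                                            [ u t ≟ i ] [ v t ≟ i ] (y (u t)) (y (v t)) p (e t)))) ⟩
      ∑[ t < m ] (edgeOutflow y i t - ([ u t ≟ i ] + [ v t ≟ i ]) * e t)
    ≡⟨ ∑-distrib-- m (edgeOutflow y i) (λ t → ([ u t ≟ i ] + [ v t ≟ i ]) * e t) ⟩
      ∑[ t < m ] edgeOutflow y i t - incidence i e
    ≡⟨ cong (_- incidence i e) (sym (outflow≡∑ y i)) ⟩
      outflow H y i - incidence i e ∎
    where open ≡-Reasoning

  outflow-lift-midpoint : ∀ y p e t → outflow (S H) (lift y p e) (midpoint t) ≡ two * e t
  outflow-lift-midpoint y p e t = begin
      outflow (S H) (lift y p e) (midpoint t)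
    ≡⟨ outflow-midpoint (lift y p e) t ⟩
      (lift y p e (midpoint t) - lift y p e (original (u t))) + (lift y p e (midpoint t) - lift y p e (original (v t)))
    ≡⟨ cong₃ (λ a b c → (c - a) + (c - b)) (lift-original y p e (u t)) (lift-original y p e (v t)) (lift-midpoint y p e t) ⟩
      ((y (u t) + y (v t) + p + e t) - (two * y (u t) + p)) + ((y (u t) + y (v t) + p + e t) - (two * y (v t) + p))
    ≡⟨ solve 4 (λ a b p e → ((a :+ b :+ p :+ e) :- (con two :* a :+ p)) :+ ((a :+ b :+ p :+ e) :- (con two :* b :+ p)) := con two :* e) refl
         (y (u t)) (y (v t)) p (e t) ⟩
      two * e t ∎
    where open ≡-Reasoning

  ∑-degree-lift : ∀ y p e → ∑[ z < nV (S H) ] (degree (S H) z * lift y p e z)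
                  ≡ two * (two * ∑[ i < n ] (degree H i * y i) + ℕtoℚ m * two * p + ∑[ t < m ] e t)
  ∑-degree-lift y p e = begin
      ∑[ z < nV (S H) ] (degree (S H) z * lift y p e z)
    ≡⟨ ∑-vertices (λ z → degree (S H) z * lift y p e z) ⟩
      ∑[ i < n ] (degree (S H) (original i) * lift y p e (original i)) + ∑[ t < m ] (degree (S H) (midpoint t) * lift y p e (midpoint t))
    ≡⟨ cong₂ _+_ (sum-cong-≗ (λ i → cong₂ _*_ (degree-original i) (lift-original y p e i)))
                 (sum-cong-≗ (λ t → cong₂ _*_ (degree-midpoint t) (lift-midpoint y p e t))) ⟩
      ∑[ i < n ] (degree H i * (two * y i + p)) + ∑[ t < m ] (two * (y (u t) + y (v t) + p + e t))
    ≡⟨ cong₂ _+_ (sum-cong-≗ (λ i → solve 3 (λ d y p → d :* (con two :* y :+ p) := con two :* (d :* y) :+ d :* p) refl (degree H i) (y i) p))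
                 (sum-cong-≗ (λ t → solve 4 (λ a b p e → con two :* (a :+ b :+ p :+ e) := con two :* (a :+ b) :+ (con two :* p :+ con two :* e)) refl
                                       (y (u t)) (y (v t)) p (e t))) ⟩
      ∑[ i < n ] (two * (degree H i * y i) + degree H i * p) + ∑[ t < m ] (two * (y (u t) + y (v t)) + (two * p + two * e t))
    ≡⟨ cong₂ _+_ (trans (∑-distrib-+ (λ i → two * (degree H i * y i)) (λ i → degree H i * p))
                        (cong₂ _+_ (∑-*ˡ n two (λ i → degree H i * y i)) (trans (∑-*ʳ n p (degree H)) (cong (_* p) ∑-degree))))
                 (trans (∑-distrib-+ (λ t → two * (y (u t) + y (v t))) (λ t → two * p + two * e t))
                        (cong₂ _+_ (trans (∑-*ˡ m two (λ t → y (u t) + y (v t))) (cong (two *_) (sym (handshake y))))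
                                   (trans (∑-distrib-+ (λ _ → two * p) (λ t → two * e t)) (cong₂ _+_ (∑-const m (two * p)) (∑-*ˡ m two e))))) ⟩
      (two * dy + ℕtoℚ m * two * p) + (two * dy + (ℕtoℚ m * (two * p) + two * ∑[ t < m ] e t))
    ≡⟨ solve 4 (λ dy mm p se → (con two :* dy :+ mm :* con two :* p) :+ (con two :* dy :+ (mm :* (con two :* p) :+ con two :* se))
                  := con two :* (con two :* dy :+ mm :* con two :* p :+ se)) refl dy (ℕtoℚ m) p (∑[ t < m ] e t) ⟩
      two * (two * dy + ℕtoℚ m * two * p + ∑[ t < m ] e t) ∎
    where
    open ≡-Reasoning
    dy : ℚ
    dy = ∑[ i < n ] (degree H i * y i)

module SubdividedGreen (H : Graph) (G : Green H) where
  open Green G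
  open EdgeSums H
  open Subdivision H

  κ′ : ℚ
  κ′ = κ * half

  from-original : Fin n → Fin (nV (S H)) → ℚ
  from-original c = lift (g c) (half * κ′) (λ _ → - κ′)

  -- Seen from H, a unit source at the midpoint of t splits equally between its endpoints; the
  -- constants are those making the degree-weighted mean vanish.
  average : Fin m → Fin n → ℚ
  average t₀ i = half * (g (u t₀) i + g (v t₀) i)

  excess : Fin m → Fin m → ℚ
  excess t₀ t = - κ′ + half * [ t ≟ t₀ ]

  from-midpoint : Fin m → Fin (nV (S H)) → ℚ
  from-midpoint t₀ = lift (average t₀) (- (half * κ′)) (excess t₀)

  g′ : Fin (nV (S H)) → Fin (nV (S H)) → ℚ
  g′ c′ = [ from-original , from-midpoint ]′ (splitAt n c′)

  g′-original : ∀ c → g′ (original c) ≡ from-original c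
  g′-original c = cong [ from-original , from-midpoint ]′ (FP.splitAt-↑ˡ n c m)

  g′-midpoint : ∀ t → g′ (midpoint t) ≡ from-midpoint t
  g′-midpoint t = cong [ from-original , from-midpoint ]′ (FP.splitAt-↑ʳ n m t)

  source′ : Fin (nV (S H)) → Fin (nV (S H)) → ℚ
  source′ c′ i′ = [ i′ ≟ c′ ] - degree (S H) i′ * κ′

  source-original-original : ∀ c i → outflow (S H) (from-original c) (original i) ≡ source′ (original c) (original i)
  source-original-original c i = begin
      outflow (S H) (from-original c) (original i)
    ≡⟨ outflow-lift-original (g c) (half * κ′) (λ _ → - κ′) i ⟩
      outflow H (g c) i - incidence i (λ _ → - κ′)
    ≡⟨ cong₂ _-_ (g-source c i) (incidence-const i (- κ′)) ⟩
      ([ i ≟ c ] - degree H i * κ) - degree H i * (- κ′)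
    ≡⟨ solve 3 (λ a d k → (a :- d :* k) :- d :* (:- (k :* con half)) := a :- d :* (k :* con half)) refl [ i ≟ c ] (degree H i) κ ⟩
      [ i ≟ c ] - degree H i * κ′
    ≡⟨ sym (cong₂ (λ a b → a - b * κ′) (δ-original i c) (degree-original i)) ⟩
      source′ (original c) (original i) ∎
    where open ≡-Reasoning

  source-original-midpoint : ∀ c t → outflow (S H) (from-original c) (midpoint t) ≡ source′ (original c) (midpoint t)
  source-original-midpoint c t = begin
      outflow (S H) (from-original c) (midpoint t)
    ≡⟨ outflow-lift-midpoint (g c) (half * κ′) (λ _ → - κ′) t ⟩
      two * (- κ′)
    ≡⟨ solve 1 (λ k → con two :* (:- k) := con 0ℚ :- con two :* k) refl κ′ ⟩
      0ℚ - two * κ′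
    ≡⟨ sym (cong₂ (λ a b → a - b * κ′) (δ-midpoint-original t c) (degree-midpoint t)) ⟩
      source′ (original c) (midpoint t) ∎
    where open ≡-Reasoning

  source-midpoint-original : ∀ t₀ i → outflow (S H) (from-midpoint t₀) (original i) ≡ source′ (midpoint t₀) (original i)
  source-midpoint-original t₀ i = begin
      outflow (S H) (from-midpoint t₀) (original i)
    ≡⟨ outflow-lift-original y (- (half * κ′)) e i ⟩
      outflow H y i - incidence i e
    ≡⟨ cong₂ _-_ outflow-y incidence-e ⟩
      (half * ([ i ≟ u t₀ ] - degree H i * κ) + half * ([ i ≟ v t₀ ] - degree H i * κ))
        - (degree H i * (- κ′) + half * ([ i ≟ u t₀ ] + [ i ≟ v t₀ ]))
    ≡⟨ solve 4 (λ a b d k → (con half :* (a :- d :* k) :+ con half :* (b :- d :* k)) :- (d :* (:- (k :* con half)) :+ con half :* (a :+ b))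
             := con 0ℚ :- d :* (k :* con half)) refl [ i ≟ u t₀ ] [ i ≟ v t₀ ] (degree H i) κ ⟩
      0ℚ - degree H i * κ′
    ≡⟨ sym (cong₂ (λ a b → a - b * κ′) (δ-original-midpoint i t₀) (degree-original i)) ⟩
      source′ (midpoint t₀) (original i) ∎
    where
    open ≡-Reasoning
    y : Fin n → ℚ
    y = average t₀
    e : Fin m → ℚ
    e = excess t₀
    outflow-y : outflow H y i ≡ half * ([ i ≟ u t₀ ] - degree H i * κ) + half * ([ i ≟ v t₀ ] - degree H i * κ)
    outflow-y = begin
        outflow H y i
      ≡⟨ outflow-cong (λ j → solve 2 (λ a b → con half :* (a :+ b) := con half :* a :+ con half :* b :+ con 0ℚ) refl (g (u t₀) j) (g (v t₀) j)) i ⟩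
        outflow H (λ j → half * g (u t₀) j + half * g (v t₀) j + 0ℚ) i
      ≡⟨ outflow-affine half half 0ℚ (g (u t₀)) (g (v t₀)) i ⟩
        half * outflow H (g (u t₀)) i + half * outflow H (g (v t₀)) i
      ≡⟨ cong₂ (λ a b → half * a + half * b) (g-source (u t₀) i) (g-source (v t₀) i) ⟩
        half * ([ i ≟ u t₀ ] - degree H i * κ) + half * ([ i ≟ v t₀ ] - degree H i * κ) ∎
    incidence-e : incidence i e ≡ degree H i * (- κ′) + half * ([ i ≟ u t₀ ] + [ i ≟ v t₀ ])
    incidence-e = begin
        ∑[ t < m ] (([ u t ≟ i ] + [ v t ≟ i ]) * (- κ′ + half * [ t ≟ t₀ ]))
      ≡⟨ sum-cong-≗ (λ t → solve 4 (λ a k h d → a :* (:- k :+ h :* d) := a :* (:- k) :+ d :* (h :* a)) refl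
            ([ u t ≟ i ] + [ v t ≟ i ]) κ′ half [ t ≟ t₀ ]) ⟩
        ∑[ t < m ] (([ u t ≟ i ] + [ v t ≟ i ]) * (- κ′) + [ t ≟ t₀ ] * (half * ([ u t ≟ i ] + [ v t ≟ i ])))
      ≡⟨ ∑-distrib-+ (λ t → ([ u t ≟ i ] + [ v t ≟ i ]) * (- κ′)) (λ t → [ t ≟ t₀ ] * (half * ([ u t ≟ i ] + [ v t ≟ i ]))) ⟩
        incidence i (λ _ → - κ′) + ∑[ t < m ] ([ t ≟ t₀ ] * (half * ([ u t ≟ i ] + [ v t ≟ i ])))
      ≡⟨ cong₂ _+_ (incidence-const i (- κ′)) (∑-δʳ m t₀ (λ t → half * ([ u t ≟ i ] + [ v t ≟ i ]))) ⟩
        degree H i * (- κ′) + half * ([ u t₀ ≟ i ] + [ v t₀ ≟ i ])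
      ≡⟨ cong₂ (λ a b → degree H i * (- κ′) + half * (a + b)) (δ-sym (u t₀) i) (δ-sym (v t₀) i) ⟩
        degree H i * (- κ′) + half * ([ i ≟ u t₀ ] + [ i ≟ v t₀ ]) ∎

  source-midpoint-midpoint : ∀ t₀ t → outflow (S H) (from-midpoint t₀) (midpoint t) ≡ source′ (midpoint t₀) (midpoint t)
  source-midpoint-midpoint t₀ t = begin
      outflow (S H) (from-midpoint t₀) (midpoint t)
    ≡⟨ outflow-lift-midpoint (average t₀) (- (half * κ′)) (excess t₀) t ⟩
      two * (- κ′ + half * [ t ≟ t₀ ])
    ≡⟨ solve 2 (λ k d → con two :* (:- k :+ con half :* d) := d :- con two :* k) refl κ′ [ t ≟ t₀ ] ⟩
      [ t ≟ t₀ ] - two * κ′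
    ≡⟨ sym (cong₂ (λ a b → a - b * κ′) (δ-midpoint t t₀) (degree-midpoint t)) ⟩
      source′ (midpoint t₀) (midpoint t) ∎
    where open ≡-Reasoning

  g′-source : ∀ c′ i′ → outflow (S H) (g′ c′) i′ ≡ source′ c′ i′
  g′-source c′ i′ with classify c′ | classify i′
  ... | original-vertex c  | original-vertex i = trans (cong (λ x → outflow (S H) x (original i)) (g′-original c)) (source-original-original c i)
  ... | original-vertex c  | midpoint-vertex t = trans (cong (λ x → outflow (S H) x (midpoint t)) (g′-original c)) (source-original-midpoint c t)
  ... | midpoint-vertex t₀ | original-vertex i = trans (cong (λ x → outflow (S H) x (original i)) (g′-midpoint t₀)) (source-midpoint-original t₀ i)
  ... | midpoint-vertex t₀ | midpoint-vertex t = trans (cong (λ x → outflow (S H) x (midpoint t)) (g′-midpoint t₀)) (source-midpoint-midpoint t₀ t)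

  centred-original : ∀ c → ∑[ z < nV (S H) ] (degree (S H) z * from-original c z) ≡ 0ℚ
  centred-original c = begin
      ∑[ z < nV (S H) ] (degree (S H) z * from-original c z)
    ≡⟨ ∑-degree-lift (g c) (half * κ′) (λ _ → - κ′) ⟩
      two * (two * ∑[ i < n ] (degree H i * g c i) + ℕtoℚ m * two * (half * κ′) + ∑[ t < m ] (- κ′))
    ≡⟨ cong₂ (λ a b → two * (two * a + ℕtoℚ m * two * (half * κ′) + b)) (g-centred c) (∑-const m (- κ′)) ⟩
      two * (two * 0ℚ + ℕtoℚ m * two * (half * κ′) + ℕtoℚ m * (- κ′))
    ≡⟨ solve 2 (λ mm k → con two :* (con two :* con 0ℚ :+ mm :* con two :* (con half :* k) :+ mm :* (:- k)) := con 0ℚ) refl (ℕtoℚ m) κ′ ⟩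
      0ℚ ∎
    where open ≡-Reasoning

  centred-midpoint : ∀ t₀ → ∑[ z < nV (S H) ] (degree (S H) z * from-midpoint t₀ z) ≡ 0ℚ
  centred-midpoint t₀ = begin
      ∑[ z < nV (S H) ] (degree (S H) z * from-midpoint t₀ z)
    ≡⟨ ∑-degree-lift y (- (half * κ′)) e ⟩
      two * (two * ∑[ i < n ] (degree H i * y i) + ℕtoℚ m * two * (- (half * κ′)) + ∑[ t < m ] e t)
    ≡⟨ cong₂ (λ a b → two * (two * a + ℕtoℚ m * two * (- (half * κ′)) + b)) centred-y ∑-e ⟩
      two * (two * 0ℚ + ℕtoℚ m * two * (- (half * κ′)) + (ℕtoℚ m * (- κ′) + half))
    ≡⟨ solve 2 (λ mm k → con two :* (con two :* con 0ℚ :+ mm :* con two :* (:- (con half :* (k :* con half))) :+ (mm :* (:- (k :* con half)) :+ con half))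
                 := con 1ℚ :- mm :* con two :* k) refl (ℕtoℚ m) κ ⟩
      1ℚ - ℕtoℚ m * two * κ
    ≡⟨ cong (_-_ 1ℚ) κ-normalises ⟩
      1ℚ - 1ℚ
    ≡⟨ QP.+-inverseʳ 1ℚ ⟩
      0ℚ ∎
    where
    open ≡-Reasoning
    y : Fin n → ℚ
    y = average t₀
    e : Fin m → ℚ
    e = excess t₀
    centred-y : ∑[ i < n ] (degree H i * y i) ≡ 0ℚ
    centred-y = begin
        ∑[ i < n ] (degree H i * (half * (g (u t₀) i + g (v t₀) i)))
      ≡⟨ sum-cong-≗ (λ i → solve 4 (λ d h a b → d :* (h :* (a :+ b)) := h :* (d :* a) :+ h :* (d :* b)) refl (degree H i) half (g (u t₀) i) (g (v t₀) i)) ⟩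
        ∑[ i < n ] (half * (degree H i * g (u t₀) i) + half * (degree H i * g (v t₀) i))
      ≡⟨ trans (∑-distrib-+ (λ i → half * (degree H i * g (u t₀) i)) (λ i → half * (degree H i * g (v t₀) i)))
               (cong₂ _+_ (∑-*ˡ n half (λ i → degree H i * g (u t₀) i)) (∑-*ˡ n half (λ i → degree H i * g (v t₀) i))) ⟩
        half * ∑[ i < n ] (degree H i * g (u t₀) i) + half * ∑[ i < n ] (degree H i * g (v t₀) i)
      ≡⟨ cong₂ (λ a b → half * a + half * b) (g-centred (u t₀)) (g-centred (v t₀)) ⟩
        half * 0ℚ + half * 0ℚ
      ≡⟨ solve 0 (con half :* con 0ℚ :+ con half :* con 0ℚ := con 0ℚ) refl ⟩
        0ℚ ∎
    ∑-e : ∑[ t < m ] e t ≡ ℕtoℚ m * (- κ′) + half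
    ∑-e = trans (∑-distrib-+ (λ _ → - κ′) (λ t → half * [ t ≟ t₀ ]))
                (cong₂ _+_ (∑-const m (- κ′)) (trans (∑-*ˡ m half (λ t → [ t ≟ t₀ ])) (trans (cong (half *_) (∑-δ m t₀)) (QP.*-identityʳ half))))

  g′-centred : ∀ c′ → ∑[ z < nV (S H) ] (degree (S H) z * g′ c′ z) ≡ 0ℚ
  g′-centred c′ with classify c′
  ... | original-vertex c  = trans (cong (λ x → ∑[ z < nV (S H) ] (degree (S H) z * x z)) (g′-original c)) (centred-original c)
  ... | midpoint-vertex t₀ = trans (cong (λ x → ∑[ z < nV (S H) ] (degree (S H) z * x z)) (g′-midpoint t₀)) (centred-midpoint t₀)

  κ′-normalises : ℕtoℚ (nE (S H)) * two * κ′ ≡ 1ℚ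
  κ′-normalises = begin
      ℕtoℚ (m ℕ.+ m) * two * κ′           ≡⟨ cong (λ a → a * two * κ′) (ℕtoℚ-homo-+ m m) ⟩
      (ℕtoℚ m + ℕtoℚ m) * two * (κ * half) ≡⟨ solve 2 (λ mm k → (mm :+ mm) :* con two :* (k :* con half) := mm :* con two :* k) refl (ℕtoℚ m) κ ⟩
      ℕtoℚ m * two * κ                     ≡⟨ κ-normalises ⟩
      1ℚ                                   ∎
    where open ≡-Reasoning

  green : Green (S H)
  green = record { κ = κ′ ; κ-normalises = κ′-normalises ; g = g′ ; g-source = g′-source ; g-centred = g′-centred }

  ∑-edge-diagonal : ∑[ t < m ] (g (u t) (u t) + g (v t) (v t)) ≡ trace G
  ∑-edge-diagonal = sym (handshake (λ c → g c c))

  ∑-edge-crossing : ∑[ t < m ] (g (v t) (u t) + g (u t) (v t)) ≡ trace G - (ℕtoℚ n - 1ℚ)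
  ∑-edge-crossing = begin
      ∑[ t < m ] (g (v t) (u t) + g (u t) (v t))
    ≡⟨ sum-cong-≗ (λ t → solve 4 (λ a b c d → b :+ c := (a :+ d) :- ((a :- c) :+ (d :- b))) refl
                    (g (u t) (u t)) (g (v t) (u t)) (g (u t) (v t)) (g (v t) (v t))) ⟩
      ∑[ t < m ] ((g (u t) (u t) + g (v t) (v t)) - ((g (u t) (u t) - g (u t) (v t)) + (g (v t) (v t) - g (v t) (u t))))
    ≡⟨ ∑-distrib-- m (λ t → g (u t) (u t) + g (v t) (v t)) (λ t → (g (u t) (u t) - g (u t) (v t)) + (g (v t) (v t) - g (v t) (u t))) ⟩
      ∑[ t < m ] (g (u t) (u t) + g (v t) (v t)) - ∑[ t < m ] ((g (u t) (u t) - g (u t) (v t)) + (g (v t) (v t) - g (v t) (u t)))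
    ≡⟨ cong₂ _-_ ∑-edge-diagonal (sym (∑-outflow-diagonal g)) ⟩
      trace G - ∑[ i < n ] outflow H (g i) i
    ≡⟨ cong (_-_ (trace G)) ∑-outflow-diagonal-g ⟩
      trace G - (ℕtoℚ n - 1ℚ) ∎
    where
    open ≡-Reasoning
    ∑-outflow-diagonal-g : ∑[ i < n ] outflow H (g i) i ≡ ℕtoℚ n - 1ℚ
    ∑-outflow-diagonal-g = begin
        ∑[ i < n ] outflow H (g i) i
      ≡⟨ sum-cong-≗ (λ i → trans (g-source i i) (cong (_- degree H i * κ) (δ-refl i))) ⟩
        ∑[ i < n ] (1ℚ - degree H i * κ)
      ≡⟨ ∑-distrib-- n (λ _ → 1ℚ) (λ i → degree H i * κ) ⟩
        ∑[ i < n ] 1ℚ - ∑[ i < n ] (degree H i * κ)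
      ≡⟨ cong₂ _-_ (trans (∑-const n 1ℚ) (QP.*-identityʳ (ℕtoℚ n))) (trans (∑-*ʳ n κ (degree H)) (trans (cong (_* κ) ∑-degree) κ-normalises)) ⟩
        ℕtoℚ n - 1ℚ ∎

  trace-green : trace green ≡ two * two * trace G + ℕtoℚ m - ℕtoℚ n + half
  trace-green = begin
      ∑[ z < nV (S H) ] (degree (S H) z * g′ z z)
    ≡⟨ ∑-vertices (λ z → degree (S H) z * g′ z z) ⟩
      ∑[ i < n ] (degree (S H) (original i) * g′ (original i) (original i)) + ∑[ t < m ] (degree (S H) (midpoint t) * g′ (midpoint t) (midpoint t))
    ≡⟨ cong₂ _+_ (sum-cong-≗ (λ i → cong₂ _*_ (degree-original i) (trans (cong (λ x → x (original i)) (g′-original i)) (lift-original (g i) (half * κ′) (λ _ → - κ′) i))))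
                 (sum-cong-≗ (λ t → cong₂ _*_ (degree-midpoint t) (trans (cong (λ x → x (midpoint t)) (g′-midpoint t)) (lift-midpoint (average t) (- (half * κ′)) (excess t) t)))) ⟩
      ∑[ i < n ] (degree H i * (two * g i i + half * κ′))
        + ∑[ t < m ] (two * (half * (g (u t) (u t) + g (v t) (u t)) + half * (g (u t) (v t) + g (v t) (v t)) + - (half * κ′) + (- κ′ + half * [ t ≟ t ])))
    ≡⟨ cong₂ _+_ (sum-cong-≗ (λ i → solve 3 (λ d a p → d :* (con two :* a :+ p) := con two :* (d :* a) :+ d :* p) refl (degree H i) (g i i) (half * κ′)))
                 (sum-cong-≗ (λ t → trans (cong (λ δ → two * (half * (g (u t) (u t) + g (v t) (u t)) + half * (g (u t) (v t) + g (v t) (v t)) + - (half * κ′) + (- κ′ + half * δ))) (δ-refl t))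
                     (solve 6 (λ a b c d p k → con two :* (con half :* (a :+ b) :+ con half :* (c :+ d) :+ p :+ (:- k :+ con half :* con 1ℚ))
                           := ((a :+ d) :+ (b :+ c)) :+ con two :* (p :+ (:- k :+ con half))) refl
                         (g (u t) (u t)) (g (v t) (u t)) (g (u t) (v t)) (g (v t) (v t)) (- (half * κ′)) κ′))) ⟩
      ∑[ i < n ] (two * (degree H i * g i i) + degree H i * (half * κ′))
        + ∑[ t < m ] (((g (u t) (u t) + g (v t) (v t)) + (g (v t) (u t) + g (u t) (v t))) + two * (- (half * κ′) + (- κ′ + half)))
    ≡⟨ cong₂ _+_ (trans (∑-distrib-+ (λ i → two * (degree H i * g i i)) (λ i → degree H i * (half * κ′)))
                        (cong₂ _+_ (∑-*ˡ n two (λ i → degree H i * g i i)) (trans (∑-*ʳ n (half * κ′) (degree H)) (cong (_* (half * κ′)) ∑-degree))))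
                 (trans (∑-distrib-+ (λ t → (g (u t) (u t) + g (v t) (v t)) + (g (v t) (u t) + g (u t) (v t))) (λ _ → two * (- (half * κ′) + (- κ′ + half))))
                        (cong₂ _+_ (trans (∑-distrib-+ (λ t → g (u t) (u t) + g (v t) (v t)) (λ t → g (v t) (u t) + g (u t) (v t)))
                                          (cong₂ _+_ ∑-edge-diagonal ∑-edge-crossing))
                                   (∑-const m (two * (- (half * κ′) + (- κ′ + half)))))) ⟩
      (two * trace G + ℕtoℚ m * two * (half * κ′)) + ((trace G + (trace G - (ℕtoℚ n - 1ℚ))) + ℕtoℚ m * (two * (- (half * κ′) + (- κ′ + half))))
    ≡⟨ solve 4 (λ t mm nn k → (con two :* t :+ mm :* con two :* (con half :* (k :* con half))) :+ ((t :+ (t :- (nn :- con 1ℚ))) :+ mm :* (con two :* (:- (con half :* (k :* con half)) :+ (:- (k :* con half) :+ con half))))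
                  := con two :* con two :* t :+ mm :- nn :+ con half :+ con half :* (con 1ℚ :- mm :* con two :* k)) refl (trace G) (ℕtoℚ m) (ℕtoℚ n) κ ⟩
      two * two * trace G + ℕtoℚ m - ℕtoℚ n + half + half * (1ℚ - ℕtoℚ m * two * κ)
    ≡⟨ cong (λ x → two * two * trace G + ℕtoℚ m - ℕtoℚ n + half + half * (1ℚ - x)) κ-normalises ⟩
      two * two * trace G + ℕtoℚ m - ℕtoℚ n + half + half * (1ℚ - 1ℚ)
    ≡⟨ solve 1 (λ x → x :+ con half :* (con 1ℚ :- con 1ℚ) := x) refl (two * two * trace G + ℕtoℚ m - ℕtoℚ n + half) ⟩
      two * two * trace G + ℕtoℚ m - ℕtoℚ n + half ∎
    where open ≡-Reasoning

-- The recurrence and its solution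

-- 2m − 2n + 1 = 2β − 1, where the cycle rank β = m − n + 1 is preserved by subdivision.
cyclomatic : Graph → ℚ
cyclomatic H = ℕtoℚ (2 *ℕ nE H) - ℕtoℚ (2 *ℕ nV H) + ℕtoℚ 1

cyclomatic-S : ∀ H → cyclomatic (S H) ≡ cyclomatic H
cyclomatic-S H = begin
    ℕtoℚ (2 *ℕ (m ℕ.+ m)) - ℕtoℚ (2 *ℕ (n ℕ.+ m)) + 1ℚ
  ≡⟨ cong₂ (λ a b → a - b + 1ℚ) (trans (ℕtoℚ-homo-* 2 (m ℕ.+ m)) (cong (two *_) (ℕtoℚ-homo-+ m m)))
                                (trans (ℕtoℚ-homo-* 2 (n ℕ.+ m)) (cong (two *_) (ℕtoℚ-homo-+ n m))) ⟩
    two * (ℕtoℚ m + ℕtoℚ m) - two * (ℕtoℚ n + ℕtoℚ m) + 1ℚ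
  ≡⟨ solve 2 (λ m n → con two :* (m :+ m) :- con two :* (n :+ m) :+ con 1ℚ := con two :* m :- con two :* n :+ con 1ℚ) refl (ℕtoℚ m) (ℕtoℚ n) ⟩
    two * ℕtoℚ m - two * ℕtoℚ n + 1ℚ
  ≡⟨ sym (cong₂ (λ a b → a - b + 1ℚ) (ℕtoℚ-homo-* 2 m) (ℕtoℚ-homo-* 2 n)) ⟩
    cyclomatic H ∎
  where
  open ≡-Reasoning
  n m : ℕ
  n = nV H
  m = nE H

S-nV≥2 : ∀ H → nV H ≥ 2 → nV (S H) ≥ 2
S-nV≥2 H n≥2 = ℕP.≤-trans n≥2 (ℕP.m≤m+n (nV H) (nE H))

R*-unique : ∀ {H} → Connected H → nV H ≥ 2 → ∀ {r r′} → IsRStar H r → IsRStar H r′ → r′ ≡ r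
R*-unique {H} connected n≥2 r-isR* r′-isR* = trans (IsRStar⇒≡2m*trace r′-isR*) (sym (IsRStar⇒≡2m*trace r-isR*))
  where open GreenResistance H connected (green-exists H connected n≥2)

R*-exists : ∀ {H} → Connected H → nV H ≥ 2 → ∃ (IsRStar H)
R*-exists {H} connected n≥2 = _ , IsRStar-2m*trace
  where open GreenResistance H connected (green-exists H connected n≥2)

R*-subdivision : ∀ {H} → Connected H → nV H ≥ 2 → ∀ {r r′} → IsRStar H r → IsRStar (S H) r′ →
                 r′ ≡ ℕtoℚ 8 * r + two * (ℕtoℚ (nE H) * cyclomatic H)
R*-subdivision {H} connected n≥2 {r} {r′} r-isR* r′-isR* = begin
    r′
  ≡⟨ GreenResistance.IsRStar⇒≡2m*trace (S H) (Subdivision.subdivision-connected H connected) G′ r′-isR* ⟩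
    ℕtoℚ (m ℕ.+ m) * two * trace G′
  ≡⟨ cong₂ (λ a b → a * two * b) (ℕtoℚ-homo-+ m m) (SubdividedGreen.trace-green H G) ⟩
    (ℕtoℚ m + ℕtoℚ m) * two * (two * two * trace G + ℕtoℚ m - ℕtoℚ n + half)
  ≡⟨ solve 3 (λ m n t → (m :+ m) :* con two :* (con two :* con two :* t :+ m :- n :+ con half)
                := con (ℕtoℚ 8) :* (m :* con two :* t) :+ con two :* (m :* (con two :* m :- con two :* n :+ con 1ℚ))) refl (ℕtoℚ m) (ℕtoℚ n) (trace G) ⟩
    ℕtoℚ 8 * (ℕtoℚ m * two * trace G) + two * (ℕtoℚ m * (two * ℕtoℚ m - two * ℕtoℚ n + 1ℚ))
  ≡⟨ cong₂ (λ a b → ℕtoℚ 8 * a + two * (ℕtoℚ m * (b - two * ℕtoℚ n + 1ℚ))) (sym r≡2m*trace) (sym (ℕtoℚ-homo-* 2 m)) ⟩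
    ℕtoℚ 8 * r + two * (ℕtoℚ m * (ℕtoℚ (2 *ℕ m) - two * ℕtoℚ n + 1ℚ))
  ≡⟨ cong (λ b → ℕtoℚ 8 * r + two * (ℕtoℚ m * (ℕtoℚ (2 *ℕ m) - b + 1ℚ))) (sym (ℕtoℚ-homo-* 2 n)) ⟩
    ℕtoℚ 8 * r + two * (ℕtoℚ m * cyclomatic H) ∎
  where
  open ≡-Reasoning
  n m : ℕ
  n = nV H
  m = nE H
  G : Green H
  G = green-exists H connected n≥2
  G′ : Green (S H)
  G′ = SubdividedGreen.green H G
  r≡2m*trace : r ≡ ℕtoℚ m * two * trace G
  r≡2m*trace = GreenResistance.IsRStar⇒≡2m*trace H connected G r-isR*

module Iterated (G : Graph) (connected : Connected G) (n≥2 : nV G ≥ 2) where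

  S^-connected : ∀ k → Connected (S^ k G)
  S^-connected zero    = connected
  S^-connected (suc k) = Subdivision.subdivision-connected (S^ k G) (S^-connected k)

  S^-nV≥2 : ∀ k → nV (S^ k G) ≥ 2
  S^-nV≥2 zero    = n≥2
  S^-nV≥2 (suc k) = S-nV≥2 (S^ k G) (S^-nV≥2 k)

  nE-S^ : ∀ k → nE (S^ k G) ≡ 2 ^ k *ℕ nE G
  nE-S^ zero    = sym (ℕP.*-identityˡ (nE G))
  nE-S^ (suc k) = trans (cong (λ e → e ℕ.+ e) (nE-S^ k))
    (ℕS.solve 2 (λ p m → p ℕS.:* m ℕS.:+ p ℕS.:* m ℕS.:= (ℕS.con 2 ℕS.:* p) ℕS.:* m) refl (2 ^ k) (nE G))

  cyclomatic-S^ : ∀ k → cyclomatic (S^ k G) ≡ cyclomatic G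
  cyclomatic-S^ zero    = refl
  cyclomatic-S^ (suc k) = trans (cyclomatic-S (S^ k G)) (cyclomatic-S^ k)

  coefficient : ℕ → ℚ
  coefficient k = (+ (8 ^ k ∸ 2 ^ k)) / 3

  -- 8^(k+1) − 2^(k+1) = 8 (8^k − 2^k) + 6·2^k, so the coefficient obeys the recurrence of R*.
  coefficient-suc : ∀ k → coefficient (suc k) ≡ ℕtoℚ 8 * coefficient k + two * ℕtoℚ (2 ^ k)
  coefficient-suc k = begin
      (+ (8 ^ suc k ∸ 2 ^ suc k)) / 3
    ≡⟨ ℕ/≡ℕtoℚ*1/ (8 ^ suc k ∸ 2 ^ suc k) 2 ⟩
      ℕtoℚ (8 ^ suc k ∸ 2 ^ suc k) * ⅓
    ≡⟨ cong (λ a → ℕtoℚ a * ⅓) difference-suc ⟩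
      ℕtoℚ (8 *ℕ (8 ^ k ∸ 2 ^ k) ℕ.+ 6 *ℕ 2 ^ k) * ⅓
    ≡⟨ cong (_* ⅓) (trans (ℕtoℚ-homo-+ (8 *ℕ (8 ^ k ∸ 2 ^ k)) (6 *ℕ 2 ^ k)) (cong₂ _+_ (ℕtoℚ-homo-* 8 (8 ^ k ∸ 2 ^ k)) (ℕtoℚ-homo-* 6 (2 ^ k)))) ⟩
      (ℕtoℚ 8 * ℕtoℚ (8 ^ k ∸ 2 ^ k) + ℕtoℚ 6 * ℕtoℚ (2 ^ k)) * ⅓
    ≡⟨ solve 2 (λ d p → (con (ℕtoℚ 8) :* d :+ con (ℕtoℚ 6) :* p) :* con ⅓ := con (ℕtoℚ 8) :* (d :* con ⅓) :+ con two :* p) refl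
         (ℕtoℚ (8 ^ k ∸ 2 ^ k)) (ℕtoℚ (2 ^ k)) ⟩
      ℕtoℚ 8 * (ℕtoℚ (8 ^ k ∸ 2 ^ k) * ⅓) + two * ℕtoℚ (2 ^ k)
    ≡⟨ cong (λ a → ℕtoℚ 8 * a + two * ℕtoℚ (2 ^ k)) (sym (ℕ/≡ℕtoℚ*1/ (8 ^ k ∸ 2 ^ k) 2)) ⟩
      ℕtoℚ 8 * coefficient k + two * ℕtoℚ (2 ^ k) ∎
    where
    open ≡-Reasoning
    difference-suc : 8 ^ suc k ∸ 2 ^ suc k ≡ 8 *ℕ (8 ^ k ∸ 2 ^ k) ℕ.+ 6 *ℕ 2 ^ k
    difference-suc = begin
        8 *ℕ 8 ^ k ∸ 2 *ℕ 2 ^ k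
      ≡⟨ cong (λ z → 8 *ℕ z ∸ 2 *ℕ 2 ^ k) (sym (ℕP.m∸n+n≡m (ℕP.^-monoˡ-≤ k (ℕ.s≤s (ℕ.s≤s ℕ.z≤n))))) ⟩
        8 *ℕ ((8 ^ k ∸ 2 ^ k) ℕ.+ 2 ^ k) ∸ 2 *ℕ 2 ^ k
      ≡⟨ cong (_∸ 2 *ℕ 2 ^ k) (ℕS.solve 2 (λ d p → ℕS.con 8 ℕS.:* (d ℕS.:+ p) ℕS.:= (ℕS.con 8 ℕS.:* d ℕS.:+ ℕS.con 6 ℕS.:* p) ℕS.:+ ℕS.con 2 ℕS.:* p) refl (8 ^ k ∸ 2 ^ k) (2 ^ k)) ⟩
        (8 *ℕ (8 ^ k ∸ 2 ^ k) ℕ.+ 6 *ℕ 2 ^ k) ℕ.+ 2 *ℕ 2 ^ k ∸ 2 *ℕ 2 ^ k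
      ≡⟨ ℕP.m+n∸n≡m _ (2 *ℕ 2 ^ k) ⟩
        8 *ℕ (8 ^ k ∸ 2 ^ k) ℕ.+ 6 *ℕ 2 ^ k ∎

  closedForm : ℕ → ℚ → ℚ
  closedForm k r = ℕtoℚ (8 ^ k) * r + coefficient k * (ℕtoℚ (nE G) * cyclomatic G)

  closedForm-suc : ∀ k {r rₖ r′} → IsRStar (S^ k G) rₖ → IsRStar (S^ (suc k) G) r′ →
                   rₖ ≡ closedForm k r → r′ ≡ closedForm (suc k) r
  closedForm-suc k {r} {rₖ} {r′} rₖ-isR* r′-isR* rₖ≡ = begin
      r′
    ≡⟨ R*-subdivision (S^-connected k) (S^-nV≥2 k) rₖ-isR* r′-isR* ⟩
      ℕtoℚ 8 * rₖ + two * (ℕtoℚ (nE (S^ k G)) * cyclomatic (S^ k G))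
    ≡⟨ cong₃ (λ a b c → ℕtoℚ 8 * a + two * (b * c)) rₖ≡ (trans (cong ℕtoℚ (nE-S^ k)) (ℕtoℚ-homo-* (2 ^ k) (nE G))) (cyclomatic-S^ k) ⟩
      ℕtoℚ 8 * (ℕtoℚ (8 ^ k) * r + coefficient k * C) + two * (ℕtoℚ (2 ^ k) * ℕtoℚ (nE G) * cyclomatic G)
    ≡⟨ solve 6 (λ e r c p m y → con (ℕtoℚ 8) :* (e :* r :+ c :* (m :* y)) :+ con two :* (p :* m :* y)
                  := (con (ℕtoℚ 8) :* e) :* r :+ (con (ℕtoℚ 8) :* c :+ con two :* p) :* (m :* y)) refl
         (ℕtoℚ (8 ^ k)) r (coefficient k) (ℕtoℚ (2 ^ k)) (ℕtoℚ (nE G)) (cyclomatic G) ⟩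
      (ℕtoℚ 8 * ℕtoℚ (8 ^ k)) * r + (ℕtoℚ 8 * coefficient k + two * ℕtoℚ (2 ^ k)) * C
    ≡⟨ cong₂ (λ a b → a * r + b * C) (sym (ℕtoℚ-homo-* 8 (8 ^ k))) (sym (coefficient-suc k)) ⟩
      closedForm (suc k) r ∎
    where
    open ≡-Reasoning
    C : ℚ
    C = ℕtoℚ (nE G) * cyclomatic G

  R*-iterated : ∀ k {r r′} → IsRStar G r → IsRStar (S^ k G) r′ → r′ ≡ closedForm k r
  R*-iterated zero {r} {r′} r-isR* r′-isR* = begin
      r′   ≡⟨ R*-unique connected n≥2 r-isR* r′-isR* ⟩
      r    ≡⟨ solve 2 (λ r c → r := con 1ℚ :* r :+ con (coefficient 0) :* c) refl r (ℕtoℚ (nE G) * cyclomatic G) ⟩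
      closedForm 0 r ∎
    where open ≡-Reasoning
  R*-iterated (suc k) r-isR* r′-isR* =
    let (rₖ , rₖ-isR*) = R*-exists (S^-connected k) (S^-nV≥2 k)
    in closedForm-suc k rₖ-isR* r′-isR* (R*-iterated k r-isR* rₖ-isR*)

theorem3p2 : (G : Graph) → Simple G → Connected G → nV G ≥ 2 → (k : ℕ) →
    ∃ (IsRStar G) ×
    (∀ r → IsRStar G r → ∀ r′ →
      (IsRStar (S^ k G) r′ ⇔
        (r′ ≡ ℕtoℚ (8 ^ k) * r
              + ((+ (8 ^ k ∸ 2 ^ k)) / 3) * (ℕtoℚ (nE G) * (ℕtoℚ (2 *ℕ nE G) - ℕtoℚ (2 *ℕ nV G) + ℕtoℚ 1)))))
theorem3p2 G _ connected n≥2 k = R*-exists connected n≥2 , λ r r-isR* r′ →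
  mk⇔ (R*-iterated k r-isR*)
      (λ r′≡ → subst (IsRStar (S^ k G)) (trans (R*-iterated k r-isR* (proj₂ Rₖ)) (sym r′≡)) (proj₂ Rₖ))
  where
  open Iterated G connected n≥2
  Rₖ : ∃ (IsRStar (S^ k G))
  Rₖ = R*-exists (S^-connected k) (S^-nV≥2 k)
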